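{- For a finite simple graph $G$ the following statements are equivalent: (1) $G$ admits a $\{{}^rP_3, {}^bP_3, {}^bK_3, {}^{rrb}K_3, {}^{rbb}K_3\}$-free $2$-edge-colouring. (2) $G$ admits a $\{{}^rP_3, {}^bP_3, {}^rK_3, {}^{rrb}K_3, {}^{rbb}K_3\}$-free $2$-edge-colouring. (3) $G$ is the line graph of an incidence graph. (4) $G$ is a $\{\text{claw}, \text{diamond}, \text{odd-hole}, \text{even-butterfly}\}$-free graph.
   Context: Graphs are finite and simple. A $2$-edge-colouring of $G$ assigns to every edge the colour red or blue (not necessarily properly). For a set $\mathcal F$ of $2$-edge-coloured graphs, a $2$-edge-colouring of $G$ is $\mathcal F$-free if no induced $2$-edge-coloured subgraph is isomorphic (preserving colours) to a member of $\mathcal F$. Patterns on three vertices: ${}^rP_3$ (resp. ${}^bP_3$) is the path on three vertices with both edges red (resp. blue); ${}^rK_3$ (resp. ${}^bK_3$) is the triangle with all edges red (resp. blue); ${}^{rrb}K_3$ is the triangle with two red edges and one blue edge; ${}^{rbb}K_3$ is the triangle with one red edge and two blue edges. The line graph of $H$ has vertex set $E(H)$, two vertices being adjacent iff the corresponding edges share an endpoint. A graph is an incidence graph if it is bipartite with a bipartition $(X,Y)$ in which every vertex of $X$ has degree at most $2$. For uncoloured graphs, being free of a set of graphs means containing no induced subgraph isomorphic to a member. The claw is $K_{1,3}$; the diamond is $K_4$ minus one edge; an odd-hole is a chordless cycle of odd length at least $5$. For $n\ge 0$, the $n$-butterfly consists of two triangles joined by a path of length $n$ (one vertex of each triangle is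 an end of the path; for $n=0$ the two triangles share exactly one vertex). An even-butterfly is a $2n$-butterfly for some $n\ge 0$. -}

module Defs where

open import Data.Fin as Fin using (Fin; zero; suc; toℕ)
import Data.Fin.Properties as Fin
open import Data.Fin.Subset using (Subset; _∈_; ∁)
open import Data.List using (List; length; filter; allFin)
open import Data.List.Relation.Unary.All using (All)
open import Data.Nat as ℕ using (ℕ; zero; suc; _+_; _*_; _≤_; ∣_-_∣)
import Data.Nat.Properties as ℕ
open import Data.Product using (Σ-syntax; ∃-syntax; _×_; _,_; proj₁; proj₂)
import Data.Product.Properties as Product
open import Data.Refinement as Refinement using (Refinement-syntax; value)
open import Data.Sum as Sum using (_⊎_; inj₁; inj₂)
open import Data.Unit using (⊤; tt)
open import Data.Empty using (⊥)
open import Function.Bundles using (_↔_; _⇔_; module Inverse; module Equivalence)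
open import Level using (0ℓ)
open import Relation.Binary using (Rel; Symmetric; Irreflexive; Decidable; DecidableEquality)
open import Relation.Binary.PropositionalEquality using (_≡_; _≢_; refl; sym; trans)
open import Relation.Nullary using (¬_; Dec; yes; no)
open import Relation.Nullary.Decidable using (_×-dec_; _⊎-dec_; ¬?)

-- A finite simple graph is a `Graph (Fin n)`.  Other vertex types are
-- allowed because line graphs, induced subgraphs and some of the
-- forbidden patterns have more natural ones.

record Graph (V : Set) : Set₁ where
  infix 4 _~_ _~?_
  field
    _~_      : Rel V 0ℓ
    ~-sym    : Symmetric _~_
    ~-irrefl : Irreflexive _≡_ _~_
    _~?_     : Decidable _~_

record _≅_ {V W : Set} (G : Graph V) (H : Graph W) : Set where
  private
    module G = Graph G
    module H = Graph H
  field
    bijection : V ↔ W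
  open Inverse bijection public using (to; from)
  field
    adjacency : ∀ u v → (u G.~ v) ⇔ (to u H.~ to v)

infix 4 _≅_

-- Membership proofs are irrelevant, so each vertex of S occurs once.

Vertices : ∀ {n} → Subset n → Set
Vertices {n} S = [ v ∈ Fin n ∣ v ∈ S ]

induced : ∀ {n} → Graph (Fin n) → (S : Subset n) → Graph (Vertices S)
induced G S = record
  { _~_      = λ u v → value u ~ value v
  ; ~-sym    = ~-sym
  ; ~-irrefl = λ { refl → ~-irrefl refl }
  ; _~?_     = λ u v → value u ~? value v
  }
  where open Graph G

-- A set of graphs, as a predicate; `-Free` closes it under isomorphism.

GraphFamily : Set₂
GraphFamily = ∀ {W : Set} → Graph W → Set₁

_-Free_ : ∀ {n} → GraphFamily → Graph (Fin n) → Set₁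
_-Free_ {n} 𝓕 G =
  ∀ {W : Set} (F : Graph W) → 𝓕 F → (S : Subset n) → ¬ (induced G S ≅ F)

data Colour : Set where
  red blue : Colour

-- The colour of an edge may depend neither on the adjacency proof
-- (which is irrelevant) nor on the order of its endpoints.

record Colouring {V : Set} (G : Graph V) : Set where
  open Graph G
  field
    colour     : ∀ u v → .(u ~ v) → Colour
    colour-sym : ∀ u v .(e : u ~ v) → colour v u (~-sym e) ≡ colour u v e

inducedColouring : ∀ {n} {G : Graph (Fin n)} → Colouring G →
                   (S : Subset n) → Colouring (induced G S)
inducedColouring c S = record
  { colour     = λ u v e → colour (value u) (value v) e
  ; colour-sym = λ u v e → colour-sym (value u) (value v) e
  }
  where open Colouring c

record ColourIso {V W : Set} {G : Graph V} {H : Graph W}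
                 (c : Colouring G) (d : Colouring H) : Set where
  private
    module G = Graph G
    module c = Colouring c
    module d = Colouring d
  field
    iso : G ≅ H
  open _≅_ iso public
  field
    colours : ∀ u v (e : u G.~ v) →
              c.colour u v e ≡
              d.colour (to u) (to v) (Equivalence.to (adjacency u v) e)

record ColouredGraph (V : Set) : Set₁ where
  constructor _with-colouring_
  field
    graph     : Graph V
    colouring : Colouring graph

ColourFree : ∀ {m n} {G : Graph (Fin n)} →
             List (ColouredGraph (Fin m)) → Colouring G → Set₁
ColourFree {n = n} 𝓕 c =
  All (λ F → (S : Subset n) →
         ¬ ColourIso (inducedColouring c S) (ColouredGraph.colouring F)) 𝓕

complete : ∀ n → Graph (Fin n)
complete n = record
  { _~_      = _≢_
  ; ~-sym    = λ u≢v v≡u → u≢v (sym v≡u)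
  ; ~-irrefl = λ u≡v u≢v → u≢v u≡v
  ; _~?_     = λ u v → ¬? (u Fin.≟ v)
  }

Consecutive : ∀ {n} → Rel (Fin n) 0ℓ
Consecutive i j = ∣ toℕ i - toℕ j ∣ ≡ 1

∣-∣-sym : ∀ {n d} (i j : Fin n) →
          ∣ toℕ i - toℕ j ∣ ≡ d → ∣ toℕ j - toℕ i ∣ ≡ d
∣-∣-sym i j = trans (ℕ.∣-∣-comm (toℕ j) (toℕ i))

∣-∣-irrefl : ∀ {n d} (i : Fin n) → ¬ (∣ toℕ i - toℕ i ∣ ≡ suc d)
∣-∣-irrefl i eq with trans (sym (ℕ.∣n-n∣≡0 (toℕ i))) eq
... | ()

-- The path with n vertices, hence of length n ∸ 1.

path : ∀ n → Graph (Fin n)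
path n = record
  { _~_      = Consecutive
  ; ~-sym    = λ {i} {j} → ∣-∣-sym i j
  ; ~-irrefl = λ { {i} refl → ∣-∣-irrefl i }
  ; _~?_     = λ i j → ∣ toℕ i - toℕ j ∣ ℕ.≟ 1
  }

-- The cycle of length 3 + k; the second disjunct closes up the path.

cycle : ∀ k → Graph (Fin (3 + k))
cycle k = record
  { _~_      = λ i j → Consecutive i j ⊎ ∣ toℕ i - toℕ j ∣ ≡ 2 + k
  ; ~-sym    = λ {i} {j} → Sum.map (∣-∣-sym i j) (∣-∣-sym i j)
  ; ~-irrefl = λ { {i} refl → Sum.[ ∣-∣-irrefl i , ∣-∣-irrefl i ] }
  ; _~?_     = λ i j → (∣ toℕ i - toℕ j ∣ ℕ.≟ 1) ⊎-dec (∣ toℕ i - toℕ j ∣ ℕ.≟ 2 + k)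
  }

completeBipartite : ∀ m n → Graph (Fin m ⊎ Fin n)
completeBipartite m n = record
  { _~_      = Adj
  ; ~-sym    = λ {u} {v} → adj-sym u v
  ; ~-irrefl = λ { {u} refl → adj-irrefl u }
  ; _~?_     = adj?
  }
  where
  Adj : Rel (Fin m ⊎ Fin n) 0ℓ
  Adj (inj₁ _) (inj₁ _) = ⊥
  Adj (inj₁ _) (inj₂ _) = ⊤
  Adj (inj₂ _) (inj₁ _) = ⊤
  Adj (inj₂ _) (inj₂ _) = ⊥

  adj-sym : ∀ u v → Adj u v → Adj v u
  adj-sym (inj₁ _) (inj₂ _) _ = tt
  adj-sym (inj₂ _) (inj₁ _) _ = tt

  adj-irrefl : ∀ u → ¬ Adj u u
  adj-irrefl (inj₁ _) ()
  adj-irrefl (inj₂ _) ()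

  adj? : Decidable Adj
  adj? (inj₁ _) (inj₁ _) = no λ ()
  adj? (inj₁ _) (inj₂ _) = yes tt
  adj? (inj₂ _) (inj₁ _) = yes tt
  adj? (inj₂ _) (inj₂ _) = no λ ()

deleteEdge : ∀ {n} → Graph (Fin n) → Fin n → Fin n → Graph (Fin n)
deleteEdge {n} G a b = record
  { _~_      = λ u v → u ~ v × ¬ IsAB u v
  ; ~-sym    = λ (e , ne) → ~-sym e , λ ab → ne (isAB-sym ab)
  ; ~-irrefl = λ u≡v (e , _) → ~-irrefl u≡v e
  ; _~?_     = λ u v → (u ~? v) ×-dec ¬? (isAB? u v)
  }
  where
  open Graph G

  IsAB : Rel (Fin n) 0ℓ
  IsAB u v = (u ≡ a × v ≡ b) ⊎ (u ≡ b × v ≡ a)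

  isAB-sym : ∀ {u v} → IsAB v u → IsAB u v
  isAB-sym (inj₁ (p , q)) = inj₂ (q , p)
  isAB-sym (inj₂ (p , q)) = inj₁ (q , p)

  isAB? : Decidable IsAB
  isAB? u v = ((u Fin.≟ a) ×-dec (v Fin.≟ b)) ⊎-dec ((u Fin.≟ b) ×-dec (v Fin.≟ a))

monochromatic : ∀ {V} (G : Graph V) → Colour → Colouring G
monochromatic G x = record
  { colour     = λ _ _ _ → x
  ; colour-sym = λ _ _ _ → refl
  }

-- The triangle whose two edges at vertex 0 have colour x and whose
-- remaining edge has colour y.

triangle : (x y : Colour) → Colouring (complete 3)
triangle x y = record { colour = λ u v _ → col u v ; colour-sym = λ u v _ → col-sym u v }
  where
  col : Fin 3 → Fin 3 → Colour
  col zero    _       = x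
  col (suc _) zero    = x
  col (suc _) (suc _) = y

  col-sym : ∀ u v → col v u ≡ col u v
  col-sym zero    zero    = refl
  col-sym zero    (suc _) = refl
  col-sym (suc _) zero    = refl
  col-sym (suc _) (suc _) = refl

ʳP₃ ᵇP₃ ʳK₃ ᵇK₃ ʳʳᵇK₃ ʳᵇᵇK₃ : ColouredGraph (Fin 3)
ʳP₃   = path 3     with-colouring monochromatic (path 3) red
ᵇP₃   = path 3     with-colouring monochromatic (path 3) blue
ʳK₃   = complete 3 with-colouring monochromatic (complete 3) red
ᵇK₃   = complete 3 with-colouring monochromatic (complete 3) blue
ʳʳᵇK₃ = complete 3 with-colouring triangle red blue
ʳᵇᵇK₃ = complete 3 with-colouring triangle blue red

-- Each unordered edge is represented once, by its increasing pair of
-- endpoints; the proof component is irrelevant.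

Edge : ∀ {n} → Graph (Fin n) → Set
Edge {n} G = [ e ∈ Fin n × Fin n ∣ proj₁ e Fin.< proj₂ e × Graph._~_ G (proj₁ e) (proj₂ e) ]

module _ {n} {G : Graph (Fin n)} where

  infix 4 _isEndpointOf_

  _isEndpointOf_ : Fin n → Edge G → Set
  w isEndpointOf e = w ≡ proj₁ (value e) ⊎ w ≡ proj₂ (value e)

  ShareEndpoint : Rel (Edge G) 0ℓ
  ShareEndpoint e f = ∃[ w ] w isEndpointOf e × w isEndpointOf f

  _isEndpointOf?_ : ∀ w e → Dec (w isEndpointOf e)
  w isEndpointOf? e = (w Fin.≟ proj₁ (value e)) ⊎-dec (w Fin.≟ proj₂ (value e))

  shareEndpoint? : Decidable ShareEndpoint
  shareEndpoint? e f = Fin.any? λ w → (w isEndpointOf? e) ×-dec (w isEndpointOf? f)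

  edge-≟ : DecidableEquality (Edge G)
  edge-≟ = Refinement._≟_ (Product.≡-dec Fin._≟_ Fin._≟_)

lineGraph : ∀ {n} (H : Graph (Fin n)) → Graph (Edge H)
lineGraph H = record
  { _~_      = λ e f → e ≢ f × ShareEndpoint {G = H} e f
  ; ~-sym    = λ (e≢f , w , we , wf) → (λ { refl → e≢f refl }) , w , wf , we
  ; ~-irrefl = λ e≡f (e≢f , _) → e≢f e≡f
  ; _~?_     = λ e f → ¬? (edge-≟ {G = H} e f) ×-dec shareEndpoint? {G = H} e f
  }

degree : ∀ {n} → Graph (Fin n) → Fin n → ℕ
degree {n} G v = length (filter (v ~?_) (allFin n))
  where open Graph G

IsBipartition : ∀ {n} → Graph (Fin n) → Subset n → Set
IsBipartition G X = ∀ u v → u ~ v → (u ∈ X × v ∈ ∁ X) ⊎ (u ∈ ∁ X × v ∈ X)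
  where open Graph G

IsIncidenceGraph : ∀ {n} → Graph (Fin n) → Set
IsIncidenceGraph {n} G =
  Σ[ X ∈ Subset n ] IsBipartition G X × (∀ x → x ∈ X → degree G x ≤ 2)

IsLineGraphOfIncidenceGraph : ∀ {n} → Graph (Fin n) → Set₁
IsLineGraphOfIncidenceGraph G =
  Σ[ m ∈ ℕ ] Σ[ H ∈ Graph (Fin m) ] IsIncidenceGraph H × G ≅ lineGraph H

claw : Graph (Fin 1 ⊎ Fin 3)
claw = completeBipartite 1 3

diamond : Graph (Fin 4)
diamond = deleteEdge (complete 4) zero (suc zero)

data End : Set where
  left right : End

-- `on i` are the n + 1 vertices of the path of length n; `off s` are
-- the two vertices of the triangle at end s that are not on the path.

data ButterflyVertex (n : ℕ) : Set where
  on  : Fin (suc n) → ButterflyVertex n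
  off : End → Fin 2 → ButterflyVertex n

butterfly : ∀ n → Graph (ButterflyVertex n)
butterfly n = record
  { _~_      = Adj
  ; ~-sym    = λ {u} {v} → adj-sym u v
  ; ~-irrefl = λ { {u} refl → adj-irrefl u }
  ; _~?_     = adj?
  }
  where
  module P = Graph (path (suc n))

  IsEnd : End → Fin (suc n) → Set
  IsEnd left  i = toℕ i ≡ 0
  IsEnd right i = toℕ i ≡ n

  Adj : Rel (ButterflyVertex n) 0ℓ
  Adj (on i)    (on j)    = i P.~ j
  Adj (on i)    (off s _) = IsEnd s i
  Adj (off s _) (on i)    = IsEnd s i
  Adj (off s a) (off t b) = s ≡ t × a ≢ b

  adj-sym : ∀ u v → Adj u v → Adj v u
  adj-sym (on i)    (on j)    e         = P.~-sym {i} {j} e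
  adj-sym (on _)    (off _ _) e         = e
  adj-sym (off _ _) (on _)    e         = e
  adj-sym (off s a) (off _ b) (refl , ne) = refl , λ { refl → ne refl }

  adj-irrefl : ∀ u → ¬ Adj u u
  adj-irrefl (on i)    e        = P.~-irrefl {i} refl e
  adj-irrefl (off _ _) (_ , ne) = ne refl

  isEnd? : ∀ s i → Dec (IsEnd s i)
  isEnd? left  i = toℕ i ℕ.≟ 0
  isEnd? right i = toℕ i ℕ.≟ n

  _≟ₛ_ : DecidableEquality End
  left  ≟ₛ left  = yes refl
  left  ≟ₛ right = no λ ()
  right ≟ₛ left  = no λ ()
  right ≟ₛ right = yes refl

  adj? : Decidable Adj
  adj? (on i)    (on j)    = i P.~? j
  adj? (on i)    (off s _) = isEnd? s i
  adj? (off s _) (on i)    = isEnd? s i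
  adj? (off s a) (off t b) = (s ≟ₛ t) ×-dec ¬? (a Fin.≟ b)

-- `cycle (2 + 2 * k)` has 5 + 2k vertices.

data ClawDiamondOddHoleEvenButterfly : {W : Set} → Graph W → Set₁ where
  is-claw           : ClawDiamondOddHoleEvenButterfly claw
  is-diamond        : ClawDiamondOddHoleEvenButterfly diamond
  is-odd-hole       : ∀ k → ClawDiamondOddHoleEvenButterfly (cycle (2 + 2 * k))
  is-even-butterfly : ∀ n → ClawDiamondOddHoleEvenButterfly (butterfly (2 * n))

{-# OPTIONS --safe #-}

-- All four statements say that G has a two-valued edge colouring in which
-- the two edges of every induced P₃ differ and the edges of every triangle
-- have the value true.
--
-- For (4) ⇒ (1): without claws and diamonds, the neighbourhood of each
-- vertex v is a disjoint union of at most two cliques, so the colouring is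
-- determined by one bit per vertex, the phase, subject to one linear
-- equation over 𝔽₂ per edge.  Adding the vertices one at a time, the
-- equations at a new vertex can be met by shifting the phases of whole
-- components, unless a shortest path between its two cliques closes up to
-- an odd hole.  Finally, each component may be flipped, so that its
-- triangles get the value true; if two triangles in a component disagree,
-- a shortest path between such triangles yields an even butterfly.

module Submission where

open import Defs
open import Data.Bool using (Bool; true; false; not; _xor_)
open import Data.Bool.Properties using (¬-not; not-¬; not-involutive; not-injective)
import Data.Bool.Properties as Bool
open import Data.Empty using (⊥; ⊥-elim)
open import Data.Fin as Fin using (Fin; zero; suc; toℕ; splitAt; _↑ˡ_; _↑ʳ_)
import Data.Fin.Properties as Fin
open import Data.Fin.Subset using (Subset; _∈_; ∁)
import Data.Fin.Subset.Properties as Subset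
open import Data.Irrelevant using ([_])
open import Data.List using (List; []; _∷_; length; filter; allFin)
import Data.List.Membership.Propositional as List
open import Data.List.Membership.Propositional.Properties using (∈-filter⁺; ∈-allFin)
open import Data.List.Relation.Unary.All using (All; []; _∷_)
open import Data.List.Relation.Unary.All.Properties using (all-filter)
open import Data.List.Relation.Unary.AllPairs using ([]; _∷_)
open import Data.List.Relation.Unary.Any using (here; there)
open import Data.List.Relation.Unary.Unique.Propositional using (Unique)
import Data.List.Relation.Unary.Unique.Propositional.Properties as Unique
open import Data.Nat as ℕ using (ℕ; zero; suc; _+_; _*_; _≤_; _<_; z≤n; s≤s; ∣_-_∣)
import Data.Nat.Properties as ℕ
open import Data.Product using (Σ-syntax; ∃; ∃-syntax; _×_; _,_; proj₁; proj₂)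
import Data.Product.Properties as Product
open import Data.Refinement using (value; value-injective; _,_)
open import Data.Sum using (_⊎_; inj₁; inj₂; [_,_]′)
import Data.Vec as Vec
import Data.Vec.Properties as Vec
open import Function using (_∘_; id; case_of_)
open import Function.Bundles using (_⇔_; mk⇔; mk↔ₛ′; module Inverse; module Equivalence)
import Function.Properties.Equivalence as ⇔
open import Level using (0ℓ)
import Relation.Binary as Binary
open import Relation.Binary.Construct.Closure.ReflexiveTransitive using (Star; ε; _◅_; _◅◅_; gmap; reverse)
open import Relation.Binary.PropositionalEquality
  using (_≡_; _≢_; _≗_; refl; sym; trans; cong; cong₂; subst; subst₂; ≢-sym; module ≡-Reasoning)
open import Relation.Nullary using (¬_; Dec; yes; no; contradiction; does)
open import Relation.Nullary.Decidable
  using (recompute; map′; _×-dec_; _⊎-dec_; decidable-stable; dec-true; dec-false; does-⇔)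
open import Relation.Unary using (Pred; Decidable)

-- In a clique colouring the edges of value true form disjoint cliques and those of value false a
-- matching: two edges of equal value at a vertex have adjacent ends, and a false edge lies in no
-- triangle. This is what (3) encodes: the cliques consist of the edges of `H` at vertices outside
-- `X`, the matching of the pairs of edges at vertices of `X`, and the degree bound 2 says that
-- false classes have at most two elements. The obstacle in (4) ⇒ (1) is that one component of the
-- smaller graph may contain several neighbours of the new vertex, each prescribing its own shift.
-- Neighbours in the same clique agree because they are adjacent; others are compared along a path,
-- which is why `Balanced` carries components and connecting walks. Shortest paths run between sets
-- of vertices, not between two fixed vertices: minimality over whole sets controls not only the
-- chords of the path but also how the further vertices of a hole or butterfly attach to it.

-- Induced subgraphs as embeddings

record Embedding {V W : Set} (F : Graph W) (G : Graph V) : Set where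
  private
    module F = Graph F
    module G = Graph G
  field
    at        : W → V
    injective : ∀ {i j} → at i ≡ at j → i ≡ j
    preserves : ∀ {i j} → i F.~ j → at i G.~ at j
    reflects  : ∀ {i j} → at i G.~ at j → i F.~ j

-- Turns the image of an embedding of a pattern on `W` into a `Subset`, and recovers preimages from
-- irrelevant membership proofs.
Searchable : Set → Set₁
Searchable W = ∀ {P : W → Set} → (∀ w → Dec (P w)) → Dec (∃ P)

module _ {n} {W : Set} {F : Graph W} {G : Graph (Fin n)} where
  private
    module F = Graph F
    module G = Graph G

  induced⇒embedding : ∀ S → induced G S ≅ F → Embedding F G
  induced⇒embedding S φ = record
    { at        = value ∘ from
    ; injective = λ {i} {j} eq → trans (sym (to∘from i)) (trans (cong to (value-injective eq)) (to∘from j))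
    ; preserves = λ {i} {j} i~j → Equivalence.from (adjacency (from i) (from j))
                    (subst₂ F._~_ (sym (to∘from i)) (sym (to∘from j)) i~j)
    ; reflects  = λ {i} {j} e → subst₂ F._~_ (to∘from i) (to∘from j)
                    (Equivalence.to (adjacency (from i) (from j)) e)
    }
    where
    open _≅_ φ
    to∘from = Inverse.strictlyInverseˡ bijection

  module Image (search : Searchable W) (ι : Embedding F G) where
    open Embedding ι

    inImage? : ∀ v → Dec (∃[ w ] at w ≡ v)
    inImage? v = search λ w → at w Fin.≟ v

    image : Subset n
    image = Vec.tabulate λ v → does (inImage? v)

    ∈-image⁺ : ∀ w → at w ∈ image
    ∈-image⁺ w = Vec.lookup⇒[]= (at w) image
      (trans (Vec.lookup∘tabulate _ (at w)) (dec-true (inImage? (at w)) (w , refl)))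

    ∈-image⁻ : ∀ {v} → v ∈ image → ∃[ w ] at w ≡ v
    ∈-image⁻ {v} v∈S
      with inImage? v
         | trans (sym (Vec.lookup∘tabulate (λ v → does (inImage? v)) v)) (Vec.[]=⇒lookup v∈S)
    ... | yes w | _ = w

    preimage : (v : Vertices image) → ∃[ w ] at w ≡ value v
    preimage (v , [ v∈S ]) = recompute (inImage? v) (∈-image⁻ v∈S)

    image≅ : induced G image ≅ F
    image≅ = record
      { bijection = mk↔ₛ′ (proj₁ ∘ preimage) (λ w → at w , [ ∈-image⁺ w ])
          (λ w → injective (proj₂ (preimage (at w , [ ∈-image⁺ w ]))))
          (λ v → value-injective (proj₂ (preimage v)))
      ; adjacency = λ u v → mk⇔
          (λ e → reflects (subst₂ G._~_ (sym (proj₂ (preimage u))) (sym (proj₂ (preimage v))) e))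
          (λ e → subst₂ G._~_ (proj₂ (preimage u)) (proj₂ (preimage v)) (preserves e))
      }

    imageColours : {c : Colouring G} {d : Colouring F} →
      (∀ i j (e : i F.~ j) → Colouring.colour c (at i) (at j) (preserves e) ≡ Colouring.colour d i j e) →
      ColourIso (inducedColouring c image) d
    imageColours {c} {d} eq = record
      { iso = image≅
      ; colours = λ u v e →
          let e′ = Equivalence.to (_≅_.adjacency image≅ u v) e in
          trans (colour-cong (proj₂ (preimage u)) (proj₂ (preimage v)) (preserves e′) e)
                (eq (proj₁ (preimage u)) (proj₁ (preimage v)) e′)
      }
      where
      open Colouring c
      colour-cong : ∀ {u u′ v v′} → u′ ≡ u → v′ ≡ v → (e′ : u′ G.~ v′) (e : u G.~ v) →
                    colour u v e ≡ colour u′ v′ e′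
      colour-cong refl refl _ _ = refl

  free⇒¬embedding : {𝓕 : GraphFamily} → Searchable W → 𝓕 F → 𝓕 -Free G → ¬ Embedding F G
  free⇒¬embedding search F∈𝓕 free ι = free F F∈𝓕 (Image.image search ι) (Image.image≅ search ι)

searchFin : ∀ {n} → Searchable (Fin n)
searchFin = Fin.any?

searchSum : ∀ {V W} → Searchable V → Searchable W → Searchable (V ⊎ W)
searchSum sV sW P? = map′
  [ (λ (v , p) → inj₁ v , p) , (λ (w , p) → inj₂ w , p) ]′
  (λ { (inj₁ v , p) → inj₁ (v , p) ; (inj₂ w , p) → inj₂ (w , p) })
  (sV (P? ∘ inj₁) ⊎-dec sW (P? ∘ inj₂))

searchButterfly : ∀ {n} → Searchable (ButterflyVertex n)
searchButterfly P? = map′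
  [ (λ (i , p) → on i , p) , [ (λ (z , p) → off left z , p) , (λ (z , p) → off right z , p) ]′ ]′
  (λ { (on i , p)        → inj₁ (i , p)
     ; (off left z , p)  → inj₂ (inj₁ (z , p))
     ; (off right z , p) → inj₂ (inj₂ (z , p)) })
  (Fin.any? (P? ∘ on) ⊎-dec (Fin.any? (P? ∘ off left) ⊎-dec Fin.any? (P? ∘ off right)))

-- Colourings avoiding the three-vertex patterns

-- The colourings in (1) and (2), up to the names of the two colours:
-- true is the colour of the triangles.

record CliqueColouring {V : Set} (G : Graph V) : Set where
  open Graph G
  field
    hue      : V → V → Bool
    hue-sym  : ∀ {u v} → u ~ v → hue u v ≡ hue v u
    turn     : ∀ {u v w} → v ~ u → v ~ w → u ≢ w → ¬ u ~ w → hue v u ≢ hue v w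
    triangle-true : ∀ {u v w} → u ~ v → u ~ w → v ~ w → hue u v ≡ true

opposite : Colour → Colour
opposite red  = blue
opposite blue = red

-- `shade x` and `paint x` translate between colours and hues, with `true` standing for `x`.
shade : Colour → Colour → Bool
shade red  red  = true
shade red  blue = false
shade blue red  = false
shade blue blue = true

paint : Colour → Bool → Colour
paint x true  = x
paint x false = opposite x

paint-injective : ∀ x {p q} → paint x p ≡ paint x q → p ≡ q
paint-injective x    {true}  {true}  _ = refl
paint-injective x    {false} {false} _ = refl
paint-injective red  {true}  {false} ()
paint-injective red  {false} {true}  ()
paint-injective blue {true}  {false} ()
paint-injective blue {false} {true}  ()

shade-injective : ∀ x {y z} → shade x y ≡ shade x z → y ≡ z
shade-injective x    {red}  {red}  _ = refl
shade-injective x    {blue} {blue} _ = refl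
shade-injective red  {red}  {blue} ()
shade-injective red  {blue} {red}  ()
shade-injective blue {red}  {blue} ()
shade-injective blue {blue} {red}  ()

shade-false : ∀ x {y} → shade x y ≡ false → y ≡ opposite x
shade-false red  {blue} _ = refl
shade-false blue {red}  _ = refl

monoK₃ : Colour → ColouredGraph (Fin 3)
monoK₃ x = complete 3 with-colouring monochromatic (complete 3) x

-- `patterns red` is the list in (1) and `patterns blue` the list in (2), so both are handled by one
-- argument.
patterns : Colour → List (ColouredGraph (Fin 3))
patterns x = ʳP₃ ∷ ᵇP₃ ∷ monoK₃ (opposite x) ∷ ʳʳᵇK₃ ∷ ʳᵇᵇK₃ ∷ []

module _ {n} {G : Graph (Fin n)} where
  open Graph G

  ~⇒≢ : ∀ {u v} → u ~ v → u ≢ v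
  ~⇒≢ u~v u≡v = ~-irrefl u≡v u~v

  triple : (u v w : Fin n) → Fin 3 → Fin n
  triple u v w zero             = u
  triple u v w (suc zero)       = v
  triple u v w (suc (suc zero)) = w

  module _ {u v w : Fin n} where

    triple-injective : u ≢ v → u ≢ w → v ≢ w → ∀ {i j} → triple u v w i ≡ triple u v w j → i ≡ j
    triple-injective a b c {zero}          {zero}          _ = refl
    triple-injective a b c {zero}          {suc zero}      p = contradiction p a
    triple-injective a b c {zero}          {suc (suc zero)} p = contradiction p b
    triple-injective a b c {suc zero}      {zero}          p = contradiction (sym p) a
    triple-injective a b c {suc zero}      {suc zero}      _ = refl
    triple-injective a b c {suc zero}      {suc (suc zero)} p = contradiction p c
    triple-injective a b c {suc (suc zero)} {zero}          p = contradiction (sym p) b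
    triple-injective a b c {suc (suc zero)} {suc zero}      p = contradiction (sym p) c
    triple-injective a b c {suc (suc zero)} {suc (suc zero)} _ = refl

    P₃-embedding : v ~ u → v ~ w → u ≢ w → ¬ u ~ w → Embedding (path 3) G
    P₃-embedding vu vw u≢w u≁w = record
      { at        = triple u v w
      ; injective = triple-injective (≢-sym (~⇒≢ vu)) u≢w (~⇒≢ vw)
      ; preserves = λ {i} {j} → preserve i j
      ; reflects  = λ {i} {j} → reflect i j
      }
      where
      preserve : ∀ i j → Consecutive i j → triple u v w i ~ triple u v w j
      preserve zero             (suc zero)       _ = ~-sym vu
      preserve (suc zero)       zero             _ = vu
      preserve (suc zero)       (suc (suc zero)) _ = vw
      preserve (suc (suc zero)) (suc zero)       _ = ~-sym vw
      preserve (suc (suc zero)) (suc (suc zero)) ()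
      reflect : ∀ i j → triple u v w i ~ triple u v w j → Consecutive i j
      reflect zero             zero             e = contradiction e (~-irrefl refl)
      reflect zero             (suc zero)       e = refl
      reflect zero             (suc (suc zero)) e = contradiction e u≁w
      reflect (suc zero)       zero             e = refl
      reflect (suc zero)       (suc zero)       e = contradiction e (~-irrefl refl)
      reflect (suc zero)       (suc (suc zero)) e = refl
      reflect (suc (suc zero)) zero             e = contradiction (~-sym e) u≁w
      reflect (suc (suc zero)) (suc zero)       e = refl
      reflect (suc (suc zero)) (suc (suc zero)) e = contradiction e (~-irrefl refl)

    K₃-embedding : u ~ v → u ~ w → v ~ w → Embedding (complete 3) G
    K₃-embedding uv uw vw = record
      { at        = triple u v w
      ; injective = triple-injective (~⇒≢ uv) (~⇒≢ uw) (~⇒≢ vw)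
      ; preserves = λ {i} {j} → preserve i j
      ; reflects  = λ e i≡j → ~-irrefl (cong (triple u v w) i≡j) e
      }
      where
      preserve : ∀ i j → i ≢ j → triple u v w i ~ triple u v w j
      preserve zero             zero             i≢j = contradiction refl i≢j
      preserve zero             (suc zero)       _   = uv
      preserve zero             (suc (suc zero)) _   = uw
      preserve (suc zero)       zero             _   = ~-sym uv
      preserve (suc zero)       (suc zero)       i≢j = contradiction refl i≢j
      preserve (suc zero)       (suc (suc zero)) _   = vw
      preserve (suc (suc zero)) zero             _   = ~-sym uw
      preserve (suc (suc zero)) (suc zero)       _   = ~-sym vw
      preserve (suc (suc zero)) (suc (suc zero)) i≢j = contradiction refl i≢j

  module FromColouring (x : Colour) (c : Colouring G) (free : ColourFree (patterns x) c) where
    open Colouring c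

    noMonoP₃ : ∀ y S → ¬ ColourIso (inducedColouring c S) (monochromatic (path 3) y)
    noMonoP₃ red  = case free of λ { (f ∷ _) → f }
    noMonoP₃ blue = case free of λ { (_ ∷ f ∷ _) → f }

    noMonoK₃ : ∀ S → ¬ ColourIso (inducedColouring c S) (monochromatic (complete 3) (opposite x))
    noMonoK₃ = case free of λ { (_ ∷ _ ∷ f ∷ _) → f }

    noMixedK₃ : ∀ {y z} → y ≢ z → ∀ S → ¬ ColourIso (inducedColouring c S) (triangle y z)
    noMixedK₃ {red}  {red}  y≢z = contradiction refl y≢z
    noMixedK₃ {red}  {blue} _ = case free of λ { (_ ∷ _ ∷ _ ∷ f ∷ _) → f }
    noMixedK₃ {blue} {red}  _ = case free of λ { (_ ∷ _ ∷ _ ∷ _ ∷ f ∷ []) → f }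
    noMixedK₃ {blue} {blue} y≢z = contradiction refl y≢z

    _≟ᶜ_ : (y z : Colour) → Dec (y ≡ z)
    red  ≟ᶜ red  = yes refl
    red  ≟ᶜ blue = no λ ()
    blue ≟ᶜ red  = no λ ()
    blue ≟ᶜ blue = yes refl

    colour-turn : ∀ {u v w} (vu : v ~ u) (vw : v ~ w) → u ≢ w → ¬ u ~ w →
                  colour v u vu ≢ colour v w vw
    colour-turn {u} {v} {w} vu vw u≢w u≁w eq =
      noMonoP₃ (colour v u vu) (Image.image searchFin ι) (Image.imageColours searchFin ι col)
      where
      ι = P₃-embedding vu vw u≢w u≁w
      col : ∀ i j (e : Consecutive i j) →
            colour (triple u v w i) (triple u v w j) (Embedding.preserves ι {i} {j} e) ≡ colour v u vu
      col zero             (suc zero)       _ = colour-sym v u vu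
      col (suc zero)       zero             _ = refl
      col (suc zero)       (suc (suc zero)) _ = sym eq
      col (suc (suc zero)) (suc zero)       _ = trans (colour-sym v w vw) (sym eq)
      col (suc (suc zero)) (suc (suc zero)) ()

    colour-K₃ : ∀ {u v w} (uv : u ~ v) (uw : u ~ w) (vw : v ~ w) y z →
                colour u v uv ≡ y → colour u w uw ≡ y → colour v w vw ≡ z → y ≡ z
    colour-K₃ {u} {v} {w} uv uw vw y z p q r with y ≟ᶜ z
    ... | yes y≡z = y≡z
    ... | no  y≢z = contradiction (Image.imageColours searchFin ι col) (noMixedK₃ y≢z (Image.image searchFin ι))
      where
      ι = K₃-embedding uv uw vw
      col : ∀ i j (e : i ≢ j) →
            colour (triple u v w i) (triple u v w j) (Embedding.preserves ι {i} {j} e) ≡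
            Colouring.colour (triangle y z) i j e
      col zero             zero             i≢j = contradiction refl i≢j
      col zero             (suc zero)       _   = p
      col zero             (suc (suc zero)) _   = q
      col (suc zero)       zero             _   = trans (colour-sym u v uv) p
      col (suc zero)       (suc zero)       i≢j = contradiction refl i≢j
      col (suc zero)       (suc (suc zero)) _   = r
      col (suc (suc zero)) zero             _   = trans (colour-sym u w uw) q
      col (suc (suc zero)) (suc zero)       _   = trans (colour-sym v w vw) r
      col (suc (suc zero)) (suc (suc zero)) i≢j = contradiction refl i≢j

    ¬monoK₃ : ∀ {u v w} (uv : u ~ v) (uw : u ~ w) (vw : v ~ w) → let y = opposite x in
              colour u v uv ≡ y → colour u w uw ≡ y → colour v w vw ≢ y
    ¬monoK₃ {u} {v} {w} uv uw vw p q r =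
      noMonoK₃ (Image.image searchFin ι) (Image.imageColours searchFin ι col)
      where
      ι = K₃-embedding uv uw vw
      col : ∀ i j (e : i ≢ j) →
            colour (triple u v w i) (triple u v w j) (Embedding.preserves ι {i} {j} e) ≡ opposite x
      col zero             zero             i≢j = contradiction refl i≢j
      col zero             (suc zero)       _   = p
      col zero             (suc (suc zero)) _   = q
      col (suc zero)       zero             _   = trans (colour-sym u v uv) p
      col (suc zero)       (suc zero)       i≢j = contradiction refl i≢j
      col (suc zero)       (suc (suc zero)) _   = r
      col (suc (suc zero)) zero             _   = trans (colour-sym u w uw) q
      col (suc (suc zero)) (suc zero)       _   = trans (colour-sym v w vw) r
      col (suc (suc zero)) (suc (suc zero)) i≢j = contradiction refl i≢j

    colour-triangle : ∀ {u v w} (uv : u ~ v) (uw : u ~ w) (vw : v ~ w) → colour u v uv ≢ opposite x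
    colour-triangle {u} {v} {w} uv uw vw p with colour u w uw ≟ᶜ opposite x | colour v w vw ≟ᶜ opposite x
    ... | yes q | yes r = ¬monoK₃ uv uw vw p q r
    ... | yes q | no ¬r = ¬r (sym (colour-K₃ uv uw vw _ _ p q refl))
    ... | no ¬q | yes r = ¬q (sym (colour-K₃ (~-sym uv) vw uw _ _ (trans (colour-sym u v uv) p) r refl))
    -- Both edges at `w` avoid `opposite x`, so they agree, and `colour-K₃` at `w` gives them the
    -- colour `opposite x` of the edge `u v`.
    ... | no ¬q | no ¬r = contradiction
      (colour-K₃ (~-sym uw) (~-sym vw) uv _ _
        (colour-sym u w uw)
        (trans (colour-sym v w vw) (two-colours ¬r ¬q)) p) ¬q
      where
      two-colours : ∀ {y z t : Colour} → y ≢ t → z ≢ t → y ≡ z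
      two-colours {red}  {red}         _ _ = refl
      two-colours {blue} {blue}        _ _ = refl
      two-colours {red}  {blue} {red}  a _ = contradiction refl a
      two-colours {red}  {blue} {blue} _ b = contradiction refl b
      two-colours {blue} {red}  {red}  _ b = contradiction refl b
      two-colours {blue} {red}  {blue} a _ = contradiction refl a

    hueᶜ : Fin n → Fin n → Bool
    hueᶜ u v with u ~? v
    ... | yes e = shade x (colour u v e)
    -- An arbitrary value: `CliqueColouring` constrains hues on edges only.
    ... | no  _ = false

    hueᶜ-adj : ∀ {u v} (e : u ~ v) → hueᶜ u v ≡ shade x (colour u v e)
    hueᶜ-adj {u} {v} e with u ~? v
    ... | yes _ = refl
    ... | no ¬e = contradiction e ¬e

    cliqueColouring : CliqueColouring G
    cliqueColouring = record
      { hue = hueᶜ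
      ; hue-sym = λ {u} {v} e → trans (hueᶜ-adj e)
          (trans (cong (shade x) (sym (colour-sym u v e))) (sym (hueᶜ-adj (~-sym e))))
      ; turn = λ vu vw u≢w u≁w eq → colour-turn vu vw u≢w u≁w
          (shade-injective x (trans (sym (hueᶜ-adj vu)) (trans eq (hueᶜ-adj vw))))
      ; triangle-true = λ uv uw vw → ¬-not λ eq →
          colour-triangle uv uw vw (shade-false x (trans (sym (hueᶜ-adj uv)) eq))
      }

  module ToColouring (x : Colour) (cc : CliqueColouring G) where
    open CliqueColouring cc

    colouring : Colouring G
    colouring = record
      { colour     = λ u v _ → paint x (hue u v)
      ; colour-sym = λ u v e → cong (paint x) (sym (hue-sym (recompute (u ~? v) e)))
      }

    module _ {F : Graph (Fin 3)} {d : Colouring F} {S} (φ : ColourIso (inducedColouring colouring S) d) where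
      open Embedding (induced⇒embedding {G = G} S (ColourIso.iso φ))

      hue-pattern : ∀ i j (e : Graph._~_ F i j) → paint x (hue (at i) (at j)) ≡ Colouring.colour d i j e
      hue-pattern i j e = trans (ColourIso.colours φ (from i) (from j) (preserves e))
        (colour-cong (to∘from i) (to∘from j) (Equivalence.to (adjacency (from i) (from j)) (preserves e)) e)
        where
        open ColourIso φ using (from; bijection; adjacency)
        to∘from = Inverse.strictlyInverseˡ bijection
        colour-cong : ∀ {u u′ v v′} → u′ ≡ u → v′ ≡ v → (e′ : Graph._~_ F u′ v′) (e : Graph._~_ F u v) →
                      Colouring.colour d u′ v′ e′ ≡ Colouring.colour d u v e
        colour-cong refl refl _ _ = refl

    noMonoP₃ : ∀ y S → ¬ ColourIso (inducedColouring colouring S) (monochromatic (path 3) y)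
    noMonoP₃ y S φ = turn (preserves {suc zero} {zero} refl) (preserves {suc zero} {suc (suc zero)} refl)
      (λ eq → case injective eq of λ ()) (λ e → case reflects {zero} {suc (suc zero)} e of λ ())
      (paint-injective x (trans (hue-pattern φ (suc zero) zero refl)
                                (sym (hue-pattern φ (suc zero) (suc (suc zero)) refl))))
      where open Embedding (induced⇒embedding {G = G} S (ColourIso.iso φ))

    -- Covers all three triangle patterns in `patterns x`: each has an edge `i j` of the colour
    -- other than `x`, while `triangle-true` paints every triangle edge with `x`.
    noOtherK₃ : {d : Colouring (complete 3)} (i j k : Fin 3) (ij : i ≢ j) → i ≢ k → j ≢ k →
                Colouring.colour d i j ij ≡ opposite x →
                ∀ S → ¬ ColourIso (inducedColouring colouring S) d
    noOtherK₃ i j k ij ik jk eq S φ = case true≡false of λ ()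
      where
      open Embedding (induced⇒embedding {G = G} S (ColourIso.iso φ))
      true≡false : true ≡ false
      true≡false = trans (sym (triangle-true (preserves ij) (preserves ik) (preserves jk)))
                         (paint-injective x (trans (hue-pattern φ i j ij) eq))

    noMixedK₃ : ∀ {y z} → y ≢ z → ∀ S → ¬ ColourIso (inducedColouring colouring S) (triangle y z)
    noMixedK₃ {y} {z} y≢z = case choose x y≢z of λ
      { (inj₁ p) → noOtherK₃ zero (suc zero) (suc (suc zero)) (λ ()) (λ ()) (λ ()) p
      ; (inj₂ p) → noOtherK₃ (suc zero) (suc (suc zero)) zero (λ ()) (λ ()) (λ ()) p
      }
      where
      choose : ∀ x {y z} → y ≢ z → y ≡ opposite x ⊎ z ≡ opposite x
      choose red  {blue} {_}    _ = inj₁ refl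
      choose red  {red}  {blue} _ = inj₂ refl
      choose red  {red}  {red}  n = contradiction refl n
      choose blue {red}  {_}    _ = inj₁ refl
      choose blue {blue} {red}  _ = inj₂ refl
      choose blue {blue} {blue} n = contradiction refl n

    colourFree : ColourFree (patterns x) colouring
    colourFree = noMonoP₃ red ∷ noMonoP₃ blue
      ∷ noOtherK₃ zero (suc zero) (suc (suc zero)) (λ ()) (λ ()) (λ ()) refl
      ∷ noMixedK₃ (λ ()) ∷ noMixedK₃ (λ ()) ∷ []

  colouring⇔clique : ∀ x → (Σ[ c ∈ Colouring G ] ColourFree (patterns x) c) ⇔ CliqueColouring G
  colouring⇔clique x = mk⇔
    (λ (c , free) → FromColouring.cliqueColouring x c free)
    (λ cc → ToColouring.colouring x cc , ToColouring.colourFree x cc)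

-- Line graphs of incidence graphs, in coordinates

-- A vertex of G is the edge {x , y} of the incidence graph, where x is
-- the endpoint of degree at most 2.

record Coordinates {n} (G : Graph (Fin n)) (m : ℕ) : Set where
  open Graph G
  field
    x y            : Fin n → Fin m
    xy-injective   : ∀ {u v} → x u ≡ x v → y u ≡ y v → u ≡ v
    x-at-most-two  : ∀ {u v w} → x u ≡ x v → x u ≡ x w → u ≢ v → u ≢ w → ¬ v ≢ w
    adjacent⇒shared : ∀ {u v} → u ~ v → x u ≡ x v ⊎ y u ≡ y v
    shared⇒adjacent : ∀ {u v} → u ≢ v → x u ≡ x v ⊎ y u ≡ y v → u ~ v

-- The least index at which `f` is true; the extra value `n` signals that there is none.
first : ∀ {n} → (Fin n → Bool) → Fin (suc n)
first {zero}  f = zero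
first {suc n} f with f zero
... | true  = zero
... | false = suc (first (f ∘ suc))

first-cong : ∀ {n} {f g : Fin n → Bool} → f ≗ g → first f ≡ first g
first-cong {zero}  f≗g = refl
first-cong {suc n} {f} {g} f≗g with f zero | g zero | f≗g zero
... | true  | _ | refl = refl
... | false | _ | refl = cong suc (first-cong (f≗g ∘ suc))

-- The witness `w` rules out the value for "none", so both functions are true at the common first
-- index.
first-common : ∀ {n} {f g : Fin n → Bool} → first f ≡ first g → ∀ w → f w ≡ true →
               ∃[ v ] f v ≡ true × g v ≡ true
first-common {suc n} {f} {g} eq w fw with f zero in f0 | g zero in g0 | w | fw
... | true  | true  | _     | _   = zero , f0 , g0
... | false | false | suc w | fw′ =
  let v , p , q = first-common (Fin.suc-injective eq) w fw′ in suc v , p , q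
... | false | false | zero  | fw′ = case trans (sym f0) fw′ of λ ()

module _ {n} {R : Binary.Rel (Fin n) 0ℓ} (R? : Binary.Decidable R) (R-refl : ∀ {u} → R u u)
         (R-sym : ∀ {u v} → R u v → R v u) (R-trans : ∀ {u v w} → R u v → R v w → R u w) where

  -- The quotient of `Fin n` by `R`, with each class named by its least element.
  class : Fin n → Fin (suc n)
  class u = first (λ w → does (R? u w))

  class-cong : ∀ {u v} → R u v → class u ≡ class v
  class-cong {u} {v} uv = first-cong λ w → does-⇔ (mk⇔ (R-trans (R-sym uv)) (R-trans uv)) (R? u w) (R? v w)

  does-true : ∀ {u v} → does (R? u v) ≡ true → R u v
  does-true {u} {v} p with yes r ← R? u v = r

  class-injective : ∀ {u v} → class u ≡ class v → R u v
  class-injective {u} {v} eq =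
    let w , p , q = first-common eq u (dec-true (R? u u) R-refl) in
    R-trans (does-true p) (R-sym (does-true q))

module _ {n} {G : Graph (Fin n)} where
  open Graph G

  -- An edge is true when it comes from a shared `y`. Two true edges at `v` put all three vertices
  -- on one `y`, so their ends are adjacent; two false ones would put three vertices on one `x`.
  coordinates⇒clique : ∀ {m} → Coordinates G m → CliqueColouring G
  coordinates⇒clique C = record
    { hue           = λ u v → does (y u Fin.≟ y v)
    ; hue-sym       = λ {u} {v} _ → does-⇔ (mk⇔ sym sym) (y u Fin.≟ y v) (y v Fin.≟ y u)
    ; turn          = turn
    ; triangle-true = triangle-true
    }
    where
    open Coordinates C
    turn : ∀ {u v w} → v ~ u → v ~ w → u ≢ w → ¬ u ~ w →
           does (y v Fin.≟ y u) ≢ does (y v Fin.≟ y w)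
    turn {u} {v} {w} vu vw u≢w u≁w eq
      with y v Fin.≟ y u | y v Fin.≟ y w | adjacent⇒shared vu | adjacent⇒shared vw | eq
    ... | yes p | yes q | _       | _       | _ = u≁w (shared⇒adjacent u≢w (inj₂ (trans (sym p) q)))
    ... | no ¬p | no ¬q | inj₁ p  | inj₁ q  | _ = x-at-most-two p q (~⇒≢ {G = G} vu) (~⇒≢ {G = G} vw) u≢w
    ... | no ¬p | _     | inj₂ p  | _       | _ = ¬p p
    ... | _     | no ¬q | _       | inj₂ q  | _ = ¬q q

    -- If `u` and `v` shared only `x`, then `w` would either join them there as a third vertex or
    -- share `y` with both, forcing them to share `y` as well.
    triangle-true : ∀ {u v w} → u ~ v → u ~ w → v ~ w → does (y u Fin.≟ y v) ≡ true
    triangle-true {u} {v} {w} uv uw vw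
      with y u Fin.≟ y v | adjacent⇒shared uv | adjacent⇒shared uw | adjacent⇒shared vw
    ... | yes _ | _      | _      | _      = refl
    ... | no ¬p | inj₂ p | _      | _      = contradiction p ¬p
    ... | no ¬p | inj₁ p | inj₁ q | _      =
      ⊥-elim (x-at-most-two p q (~⇒≢ {G = G} uv) (~⇒≢ {G = G} uw) (~⇒≢ {G = G} vw))
    ... | no ¬p | inj₁ p | _      | inj₁ r =
      ⊥-elim (x-at-most-two p (trans p r) (~⇒≢ {G = G} uv) (~⇒≢ {G = G} uw) (~⇒≢ {G = G} vw))
    ... | no ¬p | inj₁ p | inj₂ q | inj₂ r = contradiction (trans q (sym r)) ¬p

  module FromClique (cc : CliqueColouring G) where
    open CliqueColouring cc

    -- The classes for `true` are the cliques of true edges and become the values of `y`; the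
    -- classes for `false` are the matching edges and unmatched vertices and become the values of
    -- `x`.
    Joined : Bool → Binary.Rel (Fin n) 0ℓ
    Joined b u v = u ≡ v ⊎ u ~ v × hue u v ≡ b

    joined? : ∀ b → Binary.Decidable (Joined b)
    joined? b u v = (u Fin.≟ v) ⊎-dec ((u ~? v) ×-dec (hue u v Bool.≟ b))

    joined-sym : ∀ b {u v} → Joined b u v → Joined b v u
    joined-sym b (inj₁ p)       = inj₁ (sym p)
    joined-sym b (inj₂ (e , p)) = inj₂ (~-sym e , trans (sym (hue-sym e)) p)

    -- If `u` and `w` are not adjacent, `turn` at `v` forbids equal hues; if they are, the triangle
    -- makes all three hues true.
    joined-trans : ∀ b {u v w} → Joined b u v → Joined b v w → Joined b u w
    joined-trans b (inj₁ refl) q           = q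
    joined-trans b (inj₂ p)    (inj₁ refl) = inj₂ p
    joined-trans b {u} {v} {w} (inj₂ (uv , p)) (inj₂ (vw , q)) with u Fin.≟ w | u ~? w
    ... | yes u≡w | _      = inj₁ u≡w
    ... | no _    | yes uw = inj₂ (uw , trans (triangle-true uw uv (~-sym vw))
                                             (trans (sym (triangle-true uv uw vw)) p))
    ... | no u≢w  | no ¬uw = contradiction (trans (sym (hue-sym uv)) (trans p (sym q)))
                                           (turn (~-sym uv) vw u≢w ¬uw)

    coord : Bool → Fin n → Fin (suc n)
    coord b = class (joined? b) (inj₁ refl) (joined-sym b) (joined-trans b)

    coord-cong : ∀ b {u v} → Joined b u v → coord b u ≡ coord b v
    coord-cong b = class-cong (joined? b) (inj₁ refl) (joined-sym b) (joined-trans b)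

    coord-injective : ∀ b {u v} → coord b u ≡ coord b v → Joined b u v
    coord-injective b = class-injective (joined? b) (inj₁ refl) (joined-sym b) (joined-trans b)

    clique⇒coordinates : Coordinates G (suc n)
    clique⇒coordinates = record
      { x = coord false
      ; y = coord true
      ; xy-injective = λ p q → both (coord-injective false p) (coord-injective true q)
      ; x-at-most-two = λ p q → two (coord-injective false p) (coord-injective false q)
                                    (coord-injective false (trans (sym p) q))
      ; adjacent⇒shared = adjacent⇒shared
      ; shared⇒adjacent = λ u≢v → [ related u≢v ∘ coord-injective false , related u≢v ∘ coord-injective true ]′
      }
      where
      both : ∀ {u v} → Joined false u v → Joined true u v → u ≡ v
      both (inj₁ p)       _              = p
      both (inj₂ _)       (inj₁ q)       = q
      both (inj₂ (_ , p)) (inj₂ (_ , q)) = case trans (sym p) q of λ ()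

      two : ∀ {u v w} → Joined false u v → Joined false u w → Joined false v w → u ≢ v → u ≢ w → ¬ v ≢ w
      two (inj₁ p) _ _ a b c = a p
      two _ (inj₁ p) _ a b c = b p
      two _ _ (inj₁ p) a b c = c p
      two (inj₂ (uv , p)) (inj₂ (uw , _)) (inj₂ (vw , _)) _ _ _ =
        case trans (sym p) (triangle-true uv uw vw) of λ ()

      related : ∀ {b u v} → u ≢ v → Joined b u v → u ~ v
      related u≢v (inj₁ u≡v)     = contradiction u≡v u≢v
      related u≢v (inj₂ (e , _)) = e

      adjacent⇒shared : ∀ {u v} → u ~ v → coord false u ≡ coord false v ⊎ coord true u ≡ coord true v
      adjacent⇒shared {u} {v} e with hue u v in eq
      ... | false = inj₁ (coord-cong false (inj₂ (e , eq)))
      ... | true  = inj₂ (coord-cong true (inj₂ (e , eq)))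

  module FromLineGraph {m} (H : Graph (Fin m)) (X : Subset m) (bip : IsBipartition H X)
                       (deg : ∀ i → i ∈ X → degree H i ≤ 2) (φ : G ≅ lineGraph H) where
    open _≅_ φ
    private module H = Graph H

    to-injective : ∀ {u v} → to u ≡ to v → u ≡ v
    to-injective {u} {v} eq = trans (sym (from∘to u)) (trans (cong from eq) (from∘to v))
      where from∘to = Inverse.strictlyInverseʳ bijection

    -- An `Edge` lists its ends in increasing order; here they are sorted by the bipartition
    -- instead.
    record Ends (e : Edge H) : Set where
      field
        xₑ yₑ  : Fin m
        xₑ∈X   : xₑ ∈ X
        yₑ∈∁X  : yₑ ∈ ∁ X
        x~y    : xₑ H.~ yₑ
        ends   : value e ≡ (xₑ , yₑ) ⊎ value e ≡ (yₑ , xₑ)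
    open Ends

    ends-of : ∀ e → Ends e
    ends-of ((p , q) , [ pf ]) with recompute ((p Fin.<? q) ×-dec (p H.~? q)) pf
    ... | _ , pq with bip p q pq
    ...   | inj₁ (p∈X , q∈∁X) = record { xₑ∈X = p∈X ; yₑ∈∁X = q∈∁X ; x~y = pq ; ends = inj₁ refl }
    ...   | inj₂ (p∈∁X , q∈X) = record { xₑ∈X = q∈X ; yₑ∈∁X = p∈∁X ; x~y = H.~-sym pq ; ends = inj₂ refl }

    sorted : ∀ (e : Edge H) → proj₁ (value e) Fin.< proj₂ (value e)
    sorted ((p , q) , [ pf ]) = proj₁ (recompute ((p Fin.<? q) ×-dec (p H.~? q)) pf)

    -- The two edges could still list the same ends in opposite orders; `sorted` excludes this.
    ends-injective : ∀ {e f} (E : Ends e) (F : Ends f) → xₑ E ≡ xₑ F → yₑ E ≡ yₑ F → e ≡ f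
    ends-injective {e} {f} E F refl refl = value-injective (same (ends E) (ends F) (sorted e) (sorted f))
      where
      same : ∀ {a b c d x y : Fin m} → (a , b) ≡ (x , y) ⊎ (a , b) ≡ (y , x) →
             (c , d) ≡ (x , y) ⊎ (c , d) ≡ (y , x) → a Fin.< b → c Fin.< d → (a , b) ≡ (c , d)
      same (inj₁ refl) (inj₁ refl) _ _ = refl
      same (inj₂ refl) (inj₂ refl) _ _ = refl
      same (inj₁ refl) (inj₂ refl) p q = contradiction p (ℕ.<-asym q)
      same (inj₂ refl) (inj₁ refl) p q = contradiction p (ℕ.<-asym q)

    endpoint⁻ : ∀ {e w} (E : Ends e) → _isEndpointOf_ {G = H} w e → w ≡ xₑ E ⊎ w ≡ yₑ E
    endpoint⁻ E = split (ends E)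
      where
      split : ∀ {a b x y w : Fin m} → (a , b) ≡ (x , y) ⊎ (a , b) ≡ (y , x) → w ≡ a ⊎ w ≡ b → w ≡ x ⊎ w ≡ y
      split (inj₁ refl) p        = p
      split (inj₂ refl) (inj₁ p) = inj₂ p
      split (inj₂ refl) (inj₂ p) = inj₁ p

    endpoint⁺ : ∀ {e w} (E : Ends e) → w ≡ xₑ E ⊎ w ≡ yₑ E → _isEndpointOf_ {G = H} w e
    endpoint⁺ E = split (ends E)
      where
      split : ∀ {a b x y w : Fin m} → (a , b) ≡ (x , y) ⊎ (a , b) ≡ (y , x) → w ≡ x ⊎ w ≡ y → w ≡ a ⊎ w ≡ b
      split (inj₁ refl) p        = p
      split (inj₂ refl) (inj₁ p) = inj₂ p
      split (inj₂ refl) (inj₂ p) = inj₁ p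

    E : ∀ u → Ends (to u)
    E u = ends-of (to u)

    E-injective : ∀ {u v} → xₑ (E u) ≡ xₑ (E v) → yₑ (E u) ≡ yₑ (E v) → u ≡ v
    E-injective {u} {v} p q = to-injective (ends-injective (E u) (E v) p q)

    three : ∀ {L : List (Fin m)} {a b c} → a List.∈ L → b List.∈ L → c List.∈ L →
            a ≢ b → a ≢ c → b ≢ c → ¬ length L ≤ 2
    three {_ ∷ []} (here refl) (here refl) _ a _ _ _ = a refl
    three {_ ∷ _ ∷ []} (here refl) (here refl) _ a _ _ _ = a refl
    three {_ ∷ _ ∷ []} (here refl) (there (here refl)) (here refl) _ b _ _ = b refl
    three {_ ∷ _ ∷ []} (here refl) (there (here refl)) (there (here refl)) _ _ c _ = c refl
    three {_ ∷ _ ∷ []} (there (here refl)) (here refl) (here refl) _ _ c _ = c refl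
    three {_ ∷ _ ∷ []} (there (here refl)) (here refl) (there (here refl)) _ b _ _ = b refl
    three {_ ∷ _ ∷ []} (there (here refl)) (there (here refl)) _ a _ _ _ = a refl
    three {_ ∷ _ ∷ _ ∷ _} _ _ _ _ _ _ (s≤s (s≤s ()))

    lineGraph⇒coordinates : Coordinates G m
    lineGraph⇒coordinates = record
      { x = xₑ ∘ E
      ; y = yₑ ∘ E
      ; xy-injective = E-injective
      -- Three vertices with the same `x` are three edges of `H` at one vertex of `X`, and their
      -- other ends are three distinct neighbours of it.
      ; x-at-most-two = λ {u} {v} {w} p q u≢v u≢w v≢w →
          three (neighbour u refl) (neighbour v p) (neighbour w q)
            (u≢v ∘ E-injective p) (u≢w ∘ E-injective q) (v≢w ∘ E-injective (trans (sym p) q))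
            (deg (xₑ (E u)) (xₑ∈X (E u)))
      ; adjacent⇒shared = λ {u} {v} e → let _ , w , we , wf = Equivalence.to (adjacency u v) e in
          share (endpoint⁻ (E u) we) (endpoint⁻ (E v) wf)
      ; shared⇒adjacent = λ {u} {v} u≢v s → Equivalence.from (adjacency u v)
          ((λ eq → u≢v (to-injective eq)) , common s)
      }
      where
      neighbour : ∀ {i} u → i ≡ xₑ (E u) → yₑ (E u) List.∈ filter (i H.~?_) (allFin m)
      neighbour {i} u p = ∈-filter⁺ (i H.~?_) (∈-allFin _) (subst (H._~ yₑ (E u)) (sym p) (x~y (E u)))

      apart : ∀ u v → xₑ (E u) ≢ yₑ (E v)
      apart u v eq = Subset.x∈p⇒x∉∁p (xₑ∈X (E u)) (subst (_∈ ∁ X) (sym eq) (yₑ∈∁X (E v)))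

      share : ∀ {u v w} → w ≡ xₑ (E u) ⊎ w ≡ yₑ (E u) → w ≡ xₑ (E v) ⊎ w ≡ yₑ (E v) →
              xₑ (E u) ≡ xₑ (E v) ⊎ yₑ (E u) ≡ yₑ (E v)
      share (inj₁ p) (inj₁ q) = inj₁ (trans (sym p) q)
      share (inj₂ p) (inj₂ q) = inj₂ (trans (sym p) q)
      share {u} {v} (inj₁ p) (inj₂ q) = contradiction (trans (sym p) q) (apart u v)
      share {u} {v} (inj₂ p) (inj₁ q) = contradiction (trans (sym q) p) (apart v u)

      common : ∀ {u v} → xₑ (E u) ≡ xₑ (E v) ⊎ yₑ (E u) ≡ yₑ (E v) → ShareEndpoint {G = H} (to u) (to v)
      common {u} {v} (inj₁ p) = xₑ (E u) , endpoint⁺ (E u) (inj₁ refl) , endpoint⁺ (E v) (inj₁ p)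
      common {u} {v} (inj₂ p) = yₑ (E u) , endpoint⁺ (E u) (inj₂ refl) , endpoint⁺ (E v) (inj₂ p)

  module ToLineGraph {m} (C : Coordinates G m) where
    open Coordinates C

    -- The bipartite graph between values of `x` and values of `y` with an edge for each vertex `u`
    -- of `G`; by `xy-injective` different vertices give different edges.
    Incident : Binary.Rel (Fin m ⊎ Fin m) 0ℓ
    Incident (inj₁ i) (inj₁ j) = ⊥
    Incident (inj₁ i) (inj₂ j) = ∃[ u ] x u ≡ i × y u ≡ j
    Incident (inj₂ i) (inj₁ j) = ∃[ u ] x u ≡ j × y u ≡ i
    Incident (inj₂ i) (inj₂ j) = ⊥

    incident-sym : ∀ p q → Incident p q → Incident q p
    incident-sym (inj₁ _) (inj₂ _) e = e
    incident-sym (inj₂ _) (inj₁ _) e = e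

    incident-irrefl : ∀ p → ¬ Incident p p
    incident-irrefl (inj₁ _) ()
    incident-irrefl (inj₂ _) ()

    incident? : Binary.Decidable Incident
    incident? (inj₁ i) (inj₁ j) = no λ ()
    incident? (inj₁ i) (inj₂ j) = Fin.any? λ u → (x u Fin.≟ i) ×-dec (y u Fin.≟ j)
    incident? (inj₂ i) (inj₁ j) = Fin.any? λ u → (x u Fin.≟ j) ×-dec (y u Fin.≟ i)
    incident? (inj₂ i) (inj₂ j) = no λ ()

    H : Graph (Fin (m + m))
    H = record
      { _~_      = λ p q → Incident (splitAt m p) (splitAt m q)
      ; ~-sym    = λ {p} {q} → incident-sym (splitAt m p) (splitAt m q)
      ; ~-irrefl = λ { {p} refl → incident-irrefl (splitAt m p) }
      ; _~?_     = λ p q → incident? (splitAt m p) (splitAt m q)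
      }
    private module H = Graph H

    isX : Fin m ⊎ Fin m → Bool
    isX (inj₁ _) = true
    isX (inj₂ _) = false

    X : Subset (m + m)
    X = Vec.tabulate (isX ∘ splitAt m)

    X⁺ : ∀ p {i} → splitAt m p ≡ inj₁ i → p ∈ X
    X⁺ p eq = Vec.lookup⇒[]= p X (trans (Vec.lookup∘tabulate _ p) (cong isX eq))

    X⁻ : ∀ p → p ∈ X → ∃[ i ] splitAt m p ≡ inj₁ i
    X⁻ p p∈X with splitAt m p | trans (sym (Vec.lookup∘tabulate (isX ∘ splitAt m) p)) (Vec.[]=⇒lookup p∈X)
    ... | inj₁ i | _ = i , refl

    ∁X⁺ : ∀ p {i} → splitAt m p ≡ inj₂ i → p ∈ ∁ X
    ∁X⁺ p eq = Subset.x∉p⇒x∈∁p λ p∈X → case trans (sym eq) (proj₂ (X⁻ p p∈X)) of λ ()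

    bip : IsBipartition H X
    bip p q pq with splitAt m p in eqp | splitAt m q in eqq | pq
    ... | inj₁ _ | inj₂ _ | _ = inj₁ (X⁺ p eqp , ∁X⁺ q eqq)
    ... | inj₂ _ | inj₁ _ | _ = inj₂ (∁X⁺ p eqp , X⁺ q eqq)

    splitAt-injective : ∀ {p q} → splitAt m {m} p ≡ splitAt m q → p ≡ q
    splitAt-injective {p} {q} eq =
      trans (sym (Fin.join-splitAt m m p)) (trans (cong (Fin.join m m) eq) (Fin.join-splitAt m m q))

    neighbour : ∀ {i} p → Incident (inj₁ i) (splitAt m p) → ∃[ u ] x u ≡ i × splitAt m p ≡ inj₂ (y u)
    neighbour p e with splitAt m p | e
    ... | inj₂ j | u , xu , yu = u , xu , cong inj₂ (sym yu)

    -- Three distinct neighbours of `p` would come from three distinct vertices of `G` with the same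
    -- `x`.
    deg : ∀ p → p ∈ X → degree H p ≤ 2
    deg p p∈X = short (Unique.filter⁺ (p H.~?_) (Unique.allFin⁺ (m + m))) (all-filter (p H.~?_) (allFin (m + m)))
      where
      nb : ∀ {q} → p H.~ q → ∃[ u ] x u ≡ proj₁ (X⁻ p p∈X) × splitAt m q ≡ inj₂ (y u)
      nb {q} pq = neighbour q (subst (λ z → Incident z (splitAt m q)) (proj₂ (X⁻ p p∈X)) pq)
      distinct : ∀ {q q′} (e : p H.~ q) (e′ : p H.~ q′) → q ≢ q′ → proj₁ (nb {q} e) ≢ proj₁ (nb {q′} e′)
      distinct {q} {q′} e e′ q≢q′ eq = q≢q′ (splitAt-injective
        (trans (proj₂ (proj₂ (nb {q} e))) (trans (cong (inj₂ ∘ y) eq) (sym (proj₂ (proj₂ (nb {q′} e′)))))))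
      short : ∀ {L} → Unique L → All (p H.~_) L → length L ≤ 2
      short {[]}        _ _ = z≤n
      short {_ ∷ []}    _ _ = s≤s z≤n
      short {_ ∷ _ ∷ []} _ _ = s≤s (s≤s z≤n)
      short {q₁ ∷ q₂ ∷ q₃ ∷ _} ((a ∷ b ∷ _) ∷ (c ∷ _) ∷ _) (e₁ ∷ e₂ ∷ e₃ ∷ _) = ⊥-elim
        (x-at-most-two (trans (x-of e₁) (sym (x-of e₂))) (trans (x-of e₁) (sym (x-of e₃)))
          (distinct e₁ e₂ a) (distinct e₁ e₃ b) (distinct e₂ e₃ c))
        where
        x-of : ∀ {q} (e : p H.~ q) → x (proj₁ (nb {q} e)) ≡ proj₁ (X⁻ p p∈X)
        x-of {q} e = proj₁ (proj₂ (nb {q} e))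

    ends : Fin n → Fin (m + m) × Fin (m + m)
    ends u = x u ↑ˡ m , m ↑ʳ y u

    -- The `x` copy of `Fin m` precedes the `y` copy, so `ends u` is always in the increasing order
    -- that `Edge` demands.
    left<right : ∀ (i j : Fin m) → i ↑ˡ m Fin.< m ↑ʳ j
    left<right i j = subst₂ _<_ (sym (Fin.toℕ-↑ˡ i m)) (sym (Fin.toℕ-↑ʳ m j))
      (ℕ.<-≤-trans (Fin.toℕ<n i) (ℕ.m≤m+n m (toℕ j)))

    edge : Fin n → Edge H
    edge u = ends u , [ left<right (x u) (y u) ,
      subst₂ Incident (sym (Fin.splitAt-↑ˡ m (x u) m)) (sym (Fin.splitAt-↑ʳ m m (y u))) (u , refl , refl) ]

    left≢right : ∀ {i j : Fin m} → i ↑ˡ m ≢ m ↑ʳ j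
    left≢right {i} {j} eq = Fin.<⇒≢ (left<right i j) eq

    edge-injective : ∀ {u v} → edge u ≡ edge v → u ≡ v
    edge-injective {u} {v} eq = xy-injective
      (Fin.↑ˡ-injective m (x u) (x v) (cong (proj₁ ∘ value) eq))
      (Fin.↑ʳ-injective m (y u) (y v) (cong (proj₂ ∘ value) eq))

    surjective : ∀ p q → p Fin.< q → p H.~ q → ∃[ u ] ends u ≡ (p , q)
    surjective p q p<q pq with splitAt m p in eqp | splitAt m q in eqq | pq
    ... | inj₁ i | inj₂ j | u , refl , refl =
      u , cong₂ _,_ (Fin.splitAt⁻¹-↑ˡ eqp) (Fin.splitAt⁻¹-↑ʳ {m} {m} {q} eqq)
    ... | inj₂ i | inj₁ j | _ = contradiction p<q (ℕ.<-asym
      (subst₂ Fin._<_ (Fin.splitAt⁻¹-↑ˡ eqq) (Fin.splitAt⁻¹-↑ʳ {m} {m} {p} eqp) (left<right j i)))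

    label : (e : Edge H) → ∃[ u ] ends u ≡ value e
    -- The adjacency proof stored in an edge is irrelevant, so the vertex behind it is found again
    -- by search.
    label ((p , q) , [ pf ]) = recompute (Fin.any? λ u → Product.≡-dec Fin._≟_ Fin._≟_ (ends u) (p , q))
      (surjective p q (proj₁ pf) (proj₂ pf))

    coordinates⇒lineGraph : IsLineGraphOfIncidenceGraph G
    coordinates⇒lineGraph = m + m , H , (X , bip , deg) , record
      { bijection = mk↔ₛ′ edge (proj₁ ∘ label)
          (λ e → value-injective (proj₂ (label e)))
          (λ u → edge-injective (value-injective (proj₂ (label (edge u)))))
      ; adjacency = λ u v → mk⇔
          (λ e → (λ eq → ~-irrefl (edge-injective eq) e) , share⁺ u v (adjacent⇒shared e))
          (λ (e≢ , w , we , wf) → shared⇒adjacent (λ u≡v → e≢ (cong edge u≡v)) (share⁻ u v we wf))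
      }
      where
      share⁺ : ∀ u v → x u ≡ x v ⊎ y u ≡ y v → ShareEndpoint {G = H} (edge u) (edge v)
      share⁺ u v (inj₁ p) = x u ↑ˡ m , inj₁ refl , inj₁ (cong (_↑ˡ m) p)
      share⁺ u v (inj₂ p) = m ↑ʳ y u , inj₂ refl , inj₂ (cong (m ↑ʳ_) p)
      share⁻ : ∀ u v {w} → _isEndpointOf_ {G = H} w (edge u) → _isEndpointOf_ {G = H} w (edge v) →
               x u ≡ x v ⊎ y u ≡ y v
      share⁻ u v (inj₁ p) (inj₁ q) = inj₁ (Fin.↑ˡ-injective m _ _ (trans (sym p) q))
      share⁻ u v (inj₂ p) (inj₂ q) = inj₂ (Fin.↑ʳ-injective m _ _ (trans (sym p) q))
      share⁻ u v (inj₁ p) (inj₂ q) = contradiction (trans (sym p) q) left≢right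
      share⁻ u v (inj₂ p) (inj₁ q) = contradiction (trans (sym q) p) left≢right

  lineGraph⇔clique : IsLineGraphOfIncidenceGraph G ⇔ CliqueColouring G
  lineGraph⇔clique = mk⇔
    (λ (m , H , (X , bip , deg) , φ) → coordinates⇒clique (FromLineGraph.lineGraph⇒coordinates H X bip deg φ))
    (λ cc → ToLineGraph.coordinates⇒lineGraph (FromClique.clique⇒coordinates cc))

-- The forbidden subgraphs admit no clique colouring

alternating-even : ∀ (e : ℕ → Bool) k → (∀ {i} → i < 2 * k → e (suc i) ≡ not (e i)) → e (2 * k) ≡ e 0
alternating-even e zero    alt = refl
alternating-even e (suc k) alt = subst (λ m → e m ≡ e 0) (sym 2*suc)
  (trans step₂ (trans (cong not step₁) (trans (not-involutive _)
    (alternating-even e k λ i< → alt (ℕ.<-trans i< 2*k<)))))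
  where
  2*suc : 2 * suc k ≡ suc (suc (2 * k))
  2*suc = ℕ.*-suc 2 k
  2*k< : 2 * k < 2 * suc k
  2*k< = subst (2 * k <_) (sym 2*suc) (ℕ.m≤n⇒m≤1+n ℕ.≤-refl)
  step₁ : e (suc (2 * k)) ≡ not (e (2 * k))
  step₁ = alt 2*k<
  step₂ : e (suc (suc (2 * k))) ≡ not (e (suc (2 * k)))
  step₂ = alt (subst (suc (2 * k) <_) (sym 2*suc) ℕ.≤-refl)

-- Allows the vertices of a cycle or path to be indexed by natural numbers; indices beyond `n` are
-- sent to `n`.
clamp : ∀ n → ℕ → Fin (suc n)
clamp n       zero    = zero
clamp zero    (suc i) = zero
clamp (suc n) (suc i) = suc (clamp n i)

toℕ-clamp : ∀ {n i} → i ≤ n → toℕ (clamp n i) ≡ i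
toℕ-clamp z≤n       = refl
toℕ-clamp (s≤s i≤n) = cong suc (toℕ-clamp i≤n)

∣i-1+i∣≡1 : ∀ i → ∣ i - suc i ∣ ≡ 1
∣i-1+i∣≡1 zero    = refl
∣i-1+i∣≡1 (suc i) = ∣i-1+i∣≡1 i

∣i-2+i∣≡2 : ∀ i → ∣ i - 2 + i ∣ ≡ 2
∣i-2+i∣≡2 zero    = refl
∣i-2+i∣≡2 (suc i) = ∣i-2+i∣≡2 i

module _ {n i j d : ℕ} (i≤n : i ≤ n) (j≤n : j ≤ n) where

  clamp-distance⁺ : ∣ i - j ∣ ≡ d → ∣ toℕ (clamp n i) - toℕ (clamp n j) ∣ ≡ d
  clamp-distance⁺ = subst₂ (λ a b → ∣ a - b ∣ ≡ d) (sym (toℕ-clamp i≤n)) (sym (toℕ-clamp j≤n))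

  clamp-distance⁻ : ∣ toℕ (clamp n i) - toℕ (clamp n j) ∣ ≡ d → ∣ i - j ∣ ≡ d
  clamp-distance⁻ = subst₂ (λ a b → ∣ a - b ∣ ≡ d) (toℕ-clamp i≤n) (toℕ-clamp j≤n)

module _ {n} {G : Graph (Fin n)} (cc : CliqueColouring G) where
  open Graph G
  open CliqueColouring cc

  -- By `turn`, the three edges of a claw would need pairwise different hues.
  ¬claw : ¬ Embedding claw G
  ¬claw ι = three-hues (hue c (l zero)) (hue c (l (suc zero))) (hue c (l (suc (suc zero))))
    (leaves zero (suc zero) λ ()) (leaves zero (suc (suc zero)) λ ()) (leaves (suc zero) (suc (suc zero)) λ ())
    where
    open Embedding ι
    c = at (inj₁ zero)
    l : Fin 3 → Fin n
    l = at ∘ inj₂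
    leaves : ∀ i j → i ≢ j → hue c (l i) ≢ hue c (l j)
    leaves i j i≢j = turn (preserves {inj₁ zero} {inj₂ i} _) (preserves {inj₁ zero} {inj₂ j} _)
      (λ eq → i≢j (case injective eq of λ { refl → refl })) (reflects {inj₂ i} {inj₂ j})
    three-hues : ∀ (p q r : Bool) → p ≢ q → p ≢ r → q ≢ r → ⊥
    three-hues p q r p≢q p≢r q≢r = q≢r (trans (¬-not (≢-sym p≢q)) (sym (¬-not (≢-sym p≢r))))

  -- Both edges from `b` to the non-adjacent pair lie in triangles through `a`, so both are true,
  -- against `turn`.
  ¬diamond : ¬ Embedding diamond G
  ¬diamond ι = turn (preserves {b} {zero} 20′) (preserves {b} {suc zero} 21′)
    (λ eq → case injective eq of λ ())
    (λ e → case reflects {zero} {suc zero} e of λ (_ , ¬01) → ¬01 (inj₁ (refl , refl)))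
    (trans (triangle-true (preserves {b} {zero} 20′) (preserves {b} {a} 23′) (preserves {zero} {a} 03′))
           (sym (triangle-true (preserves {b} {suc zero} 21′) (preserves {b} {a} 23′)
                               (preserves {suc zero} {a} 13′))))
    where
    open Embedding ι
    module D = Graph diamond
    a b : Fin 4
    b = suc (suc zero)
    a = suc (suc (suc zero))
    20′ : b D.~ zero
    20′ = (λ ()) , λ { (inj₁ ()) ; (inj₂ ()) }
    21′ : b D.~ suc zero
    21′ = (λ ()) , λ { (inj₁ ()) ; (inj₂ ()) }
    23′ : b D.~ a
    23′ = (λ ()) , λ { (inj₁ ()) ; (inj₂ ()) }
    03′ : zero D.~ a
    03′ = (λ ()) , λ { (inj₁ (_ , ())) ; (inj₂ ()) }
    13′ : suc zero D.~ a
    13′ = (λ ()) , λ { (inj₁ ()) ; (inj₂ (_ , ())) }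

  hue-step : ∀ {u v w} → u ~ v → v ~ w → u ≢ w → ¬ u ~ w → hue v w ≡ not (hue u v)
  hue-step uv vw u≢w ¬uw = ¬-not λ eq → turn (~-sym uv) vw u≢w ¬uw
    (trans (sym (hue-sym uv)) (sym eq))

  -- Hues alternate all the way round, including across the closing edge, which is impossible for an
  -- odd number `5 + 2 * k` of edges.
  ¬oddHole : ∀ k → ¬ Embedding (cycle (2 + 2 * k)) G
  ¬oddHole k ι = not-¬ (sym e-periodic) (trans closing-step (cong not hue-around))
    where
    open Embedding ι
    -- The index of the last vertex of the hole; `p m` is joined back to `p 0`.
    m = 4 + 2 * k
    p : ℕ → Fin n
    p i = at (clamp m i)
    e : ℕ → Bool
    e i = hue (p i) (p (suc i))

    edge : ∀ {i} → i < m → p i ~ p (suc i)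
    edge {i} i<m = preserves (inj₁ (clamp-distance⁺ (ℕ.<⇒≤ i<m) i<m (∣i-1+i∣≡1 i)))
    closing : p m ~ p 0
    closing = preserves (inj₂ (clamp-distance⁺ {m} {m} {0} ℕ.≤-refl z≤n refl))

    apart : ∀ {i j d} → i ≤ m → j ≤ m → ∣ i - j ∣ ≡ d → d ≢ 0 → p i ≢ p j
    apart {i} {j} i≤m j≤m eq d≢0 pi≡pj = d≢0 (trans (sym eq) (ℕ.m≡n⇒∣m-n∣≡0 (trans (sym (toℕ-clamp i≤m))
      (trans (cong toℕ (injective pi≡pj)) (toℕ-clamp j≤m)))))
    non-adjacent : ∀ {i j d} → i ≤ m → j ≤ m → ∣ i - j ∣ ≡ d → d ≢ 1 → d ≢ m → ¬ p i ~ p j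
    non-adjacent i≤m j≤m eq d≢1 d≢m a with reflects a
    ... | inj₁ q = d≢1 (trans (sym eq) (clamp-distance⁻ i≤m j≤m q))
    ... | inj₂ q = d≢m (trans (sym eq) (clamp-distance⁻ i≤m j≤m q))

    e-step : ∀ {i} → suc i < m → e (suc i) ≡ not (e i)
    e-step {i} si<m = hue-step (edge i<m) (edge si<m)
      (apart i≤m si<m (∣i-2+i∣≡2 i) (λ ())) (non-adjacent i≤m si<m (∣i-2+i∣≡2 i) (λ ()) (λ ()))
      where
      i<m = ℕ.<-trans (ℕ.n<1+n i) si<m
      i≤m = ℕ.<⇒≤ i<m

    e-periodic : e (2 + 2 * k) ≡ e 0
    e-periodic = trans (alternating-even (e ∘ (2 +_)) k (λ i< → e-step (s≤s (s≤s (s≤s (ℕ.m≤n⇒m≤1+n i<))))))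
      (trans (e-step (s≤s (s≤s (s≤s z≤n)))) (trans (cong not (e-step (s≤s (s≤s z≤n)))) (not-involutive _)))

    hue-around : hue (p m) (p 0) ≡ e (2 + 2 * k)
    hue-around = trans
      (hue-step (edge ℕ.≤-refl) closing (apart (ℕ.n≤1+n _) z≤n refl λ ())
        (non-adjacent (ℕ.n≤1+n _) z≤n refl (λ ()) (ℕ.1+n≢n ∘ sym)))
      (trans (cong not (e-step ℕ.≤-refl)) (not-involutive _))

    closing-step : e 0 ≡ not (hue (p m) (p 0))
    closing-step = hue-step closing (edge (s≤s z≤n)) (apart ℕ.≤-refl (s≤s z≤n) refl λ ())
      (non-adjacent ℕ.≤-refl (s≤s z≤n) refl (λ ()) (ℕ.1+n≢n ∘ sym))

  -- Hues alternate along a walk that enters by an edge of the left triangle, follows the path and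
  -- leaves by an edge of the right triangle. On an even path the last edge before leaving is true
  -- like the first, yet the right triangle, being true as well, forces it to be false.
  ¬evenButterfly : ∀ k → ¬ Embedding (butterfly (2 * k)) G
  ¬evenButterfly k ι = case trans (sym (trans (alternating-even e k e-step) e-start)) e-end of λ ()
    where
    open Embedding ι
    m = 2 * k
    q : ℕ → ButterflyVertex m
    q i = on (clamp m i)
    -- Counting the edge from a left tip as edge 0 keeps the sequence nonempty for the 0-butterfly.
    prev : ℕ → ButterflyVertex m
    prev zero    = off left zero
    prev (suc i) = q i
    e : ℕ → Bool
    e i = hue (at (prev i)) (at (q i))

    edge : ∀ {i} → i ≤ m → at (prev i) ~ at (q i)
    edge {zero}  _   = preserves {off left zero} {q 0} refl
    edge {suc i} i<m = preserves {q i} {q (suc i)} (clamp-distance⁺ (ℕ.<⇒≤ i<m) i<m (∣i-1+i∣≡1 i))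

    q-injective : ∀ {i j} → i ≤ m → j ≤ m → q i ≡ q j → i ≡ j
    q-injective {i} {j} i≤m j≤m eq with clamp m i in p | clamp m j in r | eq
    ... | _ | _ | refl = trans (sym (toℕ-clamp i≤m)) (trans (cong toℕ (trans p (sym r))) (toℕ-clamp j≤m))

    e-step : ∀ {i} → i < m → e (suc i) ≡ not (e i)
    e-step {zero} 0<m = hue-step (edge z≤n) (edge 0<m) (λ eq → case injective eq of λ ())
      λ a → case trans (sym (toℕ-clamp 0<m)) (reflects {off left zero} {q 1} a) of λ ()
    e-step {suc i} si<m = hue-step (edge i<m) (edge si<m)
      (λ eq → case trans (sym (∣i-2+i∣≡2 i)) (ℕ.m≡n⇒∣m-n∣≡0 (q-injective i≤m si<m (injective eq))) of λ ())
      (λ a → case trans (sym (∣i-2+i∣≡2 i)) (clamp-distance⁻ i≤m si<m (reflects {q i} {q (2 + i)} a)) of λ ())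
      where
      i<m = ℕ.<-trans (ℕ.n<1+n i) si<m
      i≤m = ℕ.<⇒≤ i<m

    e-start : e 0 ≡ true
    e-start = triangle-true (edge z≤n) (preserves {off left zero} {off left (suc zero)} (refl , λ ()))
      (preserves {q 0} {off left (suc zero)} refl)

    e-end : e m ≡ false
    e-end = not-injective (trans
      (sym (hue-step (edge ℕ.≤-refl) last (prev≢ m) (prev≁ ℕ.≤-refl)))
      (triangle-true last
        (preserves {q m} {off right (suc zero)} (toℕ-clamp ℕ.≤-refl))
        (preserves {off right zero} {off right (suc zero)} (refl , λ ()))))
      where
      last : at (q m) ~ at (off right zero)
      last = preserves {q m} {off right zero} (toℕ-clamp ℕ.≤-refl)
      prev≢ : ∀ i → at (prev i) ≢ at (off right zero)
      prev≢ zero    eq = case injective eq of λ ()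
      prev≢ (suc i) eq = case injective eq of λ ()
      prev≁ : ∀ {i} → i ≤ m → ¬ at (prev i) ~ at (off right zero)
      prev≁ {zero} _ a = case reflects {off left zero} {off right zero} a of λ ()
      prev≁ {suc i} i<m a = ℕ.<⇒≢ i<m (trans (sym (toℕ-clamp (ℕ.<⇒≤ i<m))) (reflects {q i} {off right zero} a))

  clique⇒free : ClawDiamondOddHoleEvenButterfly -Free G
  clique⇒free F is-claw              S φ = ¬claw (induced⇒embedding S φ)
  clique⇒free F is-diamond           S φ = ¬diamond (induced⇒embedding S φ)
  clique⇒free F (is-odd-hole k)      S φ = ¬oddHole k (induced⇒embedding S φ)
  clique⇒free F (is-even-butterfly k) S φ = ¬evenButterfly k (induced⇒embedding S φ)

-- Shortest paths and the induced subgraphs built on them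

least : {P : Pred ℕ 0ℓ} → Decidable P → ∀ k → P k → ∃[ m ] P m × (∀ {j} → P j → m ≤ j)
least P? zero    pk = zero , pk , λ _ → z≤n
least {P} P? (suc k) pk with P? zero
... | yes p₀ = zero , p₀ , λ _ → z≤n
... | no ¬p₀ = let m , pm , m≤ = least (P? ∘ suc) k pk in
               suc m , pm , λ { {zero} p₀ → contradiction p₀ ¬p₀ ; {suc j} pj → s≤s (m≤ pj) }

distance-one : ∀ {i j} → i ≢ j → i ≤ suc j → j ≤ suc i → ∣ i - j ∣ ≡ 1
distance-one {zero}        {zero}        i≢j _ _ = contradiction refl i≢j
distance-one {zero}        {suc zero}    _   _ _ = refl
distance-one {zero}        {suc (suc j)} _   _ (s≤s ())
distance-one {suc zero}    {zero}        _   _ _ = refl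
distance-one {suc (suc i)} {zero}        _   (s≤s ()) _
distance-one {suc i}       {suc j}       i≢j (s≤s p) (s≤s q) = distance-one (i≢j ∘ cong suc) p q

distance-one⁻ : ∀ i j → ∣ i - j ∣ ≡ 1 → i ≡ suc j ⊎ j ≡ suc i
distance-one⁻ zero       (suc zero) _ = inj₂ refl
distance-one⁻ (suc zero) zero       _ = inj₁ refl
distance-one⁻ (suc i)    (suc j)    p with distance-one⁻ i j p
... | inj₁ q = inj₁ (cong suc q)
... | inj₂ q = inj₂ (cong suc q)

module _ {n} {G : Graph (Fin n)} where
  open Graph G

  -- The target is a set, so that a walk of minimal length is also minimal over the choice of its
  -- last vertex.
  data Walk (B : Pred (Fin n) 0ℓ) : ℕ → Fin n → Set where
    stop : ∀ {u} → B u → Walk B zero u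
    step : ∀ {u v k} → u ~ v → Walk B k v → Walk B (suc k) u

  star⇒walk : ∀ {B : Pred (Fin n) 0ℓ} {u w} → B w → Star _~_ u w → ∃[ k ] Walk B k u
  star⇒walk b ε        = zero , stop b
  star⇒walk b (e ◅ es) = let k , w = star⇒walk b es in suc k , step e w

  module _ {B : Pred (Fin n) 0ℓ} where

    walk? : Decidable B → ∀ k → Decidable (Walk B k)
    walk? B? zero    u = map′ stop (λ { (stop b) → b }) (B? u)
    walk? B? (suc k) u = map′ (λ (v , e , w) → step e w) (λ { (step {v = v} e w) → v , e , w })
      (Fin.any? λ v → (u ~? v) ×-dec walk? B? k v)

    vertices : ∀ {k u} → Walk B k u → ℕ → Fin n
    vertices {u = u} w          zero    = u
    vertices {u = u} (stop _)   (suc i) = u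
    vertices         (step _ w) (suc i) = vertices w i

    vertices-edge : ∀ {k u} (w : Walk B k u) {i} → i < k → vertices w i ~ vertices w (suc i)
    vertices-edge (step e (stop _))   {zero}  _         = e
    vertices-edge (step e (step _ _)) {zero}  _         = e
    vertices-edge (step _ w)          {suc i} (s≤s i<k) = vertices-edge w i<k

    vertices-walk : ∀ {k u} (w : Walk B k u) {i} → i ≤ k → ∃[ j ] i + j ≡ k × Walk B j (vertices w i)
    vertices-walk w          {zero}  _         = _ , refl , w
    vertices-walk (step _ w) {suc i} (s≤s i≤k) = let j , eq , w′ = vertices-walk w i≤k in j , cong suc eq , w′

  -- Shortest among all walks from `A` to `B`. Replacing an initial or final part of the path by a
  -- detour cannot shorten it; all bounds below compare `len` with such a detour.
  record ShortestPath (A B : Pred (Fin n) 0ℓ) : Set where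
    field
      len      : ℕ
      p        : ℕ → Fin n
      start    : A (p 0)
      edge     : ∀ {i} → i < len → p i ~ p (suc i)
      walk     : ∀ {i} → i ≤ len → ∃[ j ] i + j ≡ len × Walk B j (p i)
      shortest : ∀ {a j} → A a → Walk B j a → len ≤ j

    finish : B (p len)
    finish with walk ℕ.≤-refl
    ... | zero  , _  , stop b = b
    ... | suc j , eq , _      = contradiction eq (ℕ.m+1+n≢m len)

    prepend : ∀ i {j} → i ≤ len → Walk B j (p i) → Walk B (i + j) (p 0)
    prepend zero        i≤len w = w
    prepend (suc i) {j} i<len w = subst (λ k → Walk B k (p 0)) (ℕ.+-suc i j)
      (prepend i (ℕ.<⇒≤ i<len) (step (edge i<len) w))

    distance : ∀ {i j} → i ≤ len → Walk B j (p i) → len ≤ i + j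
    distance i≤len w = shortest start (prepend _ i≤len w)

    A-start : ∀ {i} → i ≤ len → A (p i) → i ≡ 0
    A-start {i} i≤len a = let j , eq , w = walk i≤len in
      ℕ.n≤0⇒n≡0 (ℕ.+-cancelʳ-≤ j i 0 (subst (_≤ j) (sym eq) (shortest a w)))

    B-end : ∀ {i} → i ≤ len → B (p i) → i ≡ len
    B-end {i} i≤len b = ℕ.≤-antisym i≤len (subst (len ≤_) (ℕ.+-identityʳ i) (distance i≤len (stop b)))

    -- Stepping from `a` to `p i` and following the path from there is another walk from `A` to `B`.
    A-near : ∀ {a i} → A a → i ≤ len → a ~ p i → i ≤ 1
    A-near {a} {i} A-a i≤len e = let j , eq , w = walk i≤len in
      ℕ.+-cancelʳ-≤ j i 1 (subst (_≤ suc j) (sym eq) (shortest A-a (step e w)))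

    B-near : ∀ {b i} → B b → i ≤ len → p i ~ b → len ≤ suc i
    B-near {b} {i} B-b i≤len e = subst (len ≤_) (ℕ.+-comm i 1) (distance i≤len (step e (stop B-b)))

    -- The first `i` edges followed by the part of the path after `p j` form a walk from `A` to `B`.
    p-≤ : ∀ {i j} → i ≤ len → j ≤ len → p i ≡ p j → j ≤ i
    p-≤ {i} {j} i≤len j≤len eq = let l , eql , w = walk j≤len in
      ℕ.+-cancelʳ-≤ l j i (subst (_≤ i + l) (sym eql) (distance i≤len (subst (Walk B l) (sym eq) w)))

    p-injective : ∀ {i j} → i ≤ len → j ≤ len → p i ≡ p j → i ≡ j
    p-injective i≤len j≤len eq = ℕ.≤-antisym (p-≤ j≤len i≤len (sym eq)) (p-≤ i≤len j≤len eq)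

    p-near : ∀ {i j} → i ≤ len → j ≤ len → p i ~ p j → j ≤ suc i
    p-near {i} {j} i≤len j≤len e = let l , eql , w = walk j≤len in
      ℕ.+-cancelʳ-≤ l j (suc i) (subst₂ _≤_ (sym eql) (ℕ.+-suc i l) (distance i≤len (step e w)))

    p-adjacent⁻ : ∀ {i j} → i ≤ len → j ≤ len → p i ~ p j → ∣ i - j ∣ ≡ 1
    p-adjacent⁻ i≤len j≤len e = distance-one (λ i≡j → ~-irrefl (cong p i≡j) e)
      (p-near j≤len i≤len (~-sym e)) (p-near i≤len j≤len e)

    p-adjacent⁺ : ∀ {i j} → i ≤ len → j ≤ len → ∣ i - j ∣ ≡ 1 → p i ~ p j
    p-adjacent⁺ {i} {j} i≤len j≤len d with distance-one⁻ i j d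
    ... | inj₁ refl = ~-sym (edge i≤len)
    ... | inj₂ refl = edge j≤len

    p-turn : ∀ {i} → 2 + i ≤ len → p i ≢ p (2 + i) × ¬ p i ~ p (2 + i)
    p-turn {i} le = (λ eq → ℕ.m≢1+n+m i (p-injective i≤len le eq))
                  , (λ e → ℕ.1+n≰n (p-near i≤len le e))
      where i≤len = ℕ.≤-trans (ℕ.m≤n+m i 2) le

  shortestPath : ∀ {A B} → Decidable A → Decidable B → ∀ {a b} → A a → B b → Star _~_ a b → ShortestPath A B
  shortestPath {A} {B} A? B? {a} A-a B-b a⟶b
    with k , w ← star⇒walk {B = B} B-b a⟶b
    with len , (a′ , A-a′ , w′) , minimal ←
         least {P = λ j → ∃[ v ] A v × Walk B j v}
           (λ j → Fin.any? λ v → A? v ×-dec walk? B? j v) k (a , A-a , w)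
    = record
      { len = len
      ; p = vertices w′
      ; start = A-a′
      ; edge = vertices-edge w′
      ; walk = vertices-walk w′
      ; shortest = λ A-v v⟶ → minimal (_ , A-v , v⟶)
      }

  module _ {N} (o : Fin n) (p : ℕ → Fin n)
           (p-injective  : ∀ {i j} → i ≤ suc N → j ≤ suc N → p i ≡ p j → i ≡ j)
           (p-adjacent⁺ : ∀ {i j} → i ≤ suc N → j ≤ suc N → ∣ i - j ∣ ≡ 1 → p i ~ p j)
           (p-adjacent⁻ : ∀ {i j} → i ≤ suc N → j ≤ suc N → p i ~ p j → ∣ i - j ∣ ≡ 1)
           (o~first : o ~ p 0) (o~last : o ~ p (suc N))
           (o-adjacent⁻ : ∀ {i} → i ≤ suc N → o ~ p i → i ≡ 0 ⊎ i ≡ suc N)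
           (o≢p : ∀ {i} → i ≤ suc N → o ≢ p i) where

    -- With `o` placed at vertex 0, its edge to `p 0` is a consecutive pair of the cycle and its
    -- edge to `p (suc N)` is the closing pair.
    cycle-embedding : Embedding (cycle N) G
    cycle-embedding = record
      { at        = vertex
      ; injective = λ {i} {j} → inj i j
      ; preserves = λ {i} {j} → preserve i j
      ; reflects  = λ {i} {j} → reflect i j
      }
      where
      vertex : Fin (3 + N) → Fin n
      vertex zero    = o
      vertex (suc i) = p (toℕ i)

      bound : (i : Fin (2 + N)) → toℕ i ≤ suc N
      bound = Fin.toℕ≤pred[n]

      inj : ∀ i j → vertex i ≡ vertex j → i ≡ j
      inj zero    zero    _  = refl
      inj zero    (suc j) eq = contradiction eq (o≢p (bound j))
      inj (suc i) zero    eq = contradiction (sym eq) (o≢p (bound i))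
      inj (suc i) (suc j) eq = cong suc (Fin.toℕ-injective (p-injective (bound i) (bound j) eq))

      spoke : ∀ {i} → suc i ≡ 1 ⊎ suc i ≡ 2 + N → o ~ p i
      spoke (inj₁ refl) = o~first
      spoke (inj₂ refl) = o~last

      spoke⁻ : ∀ {i} → i ≡ 0 ⊎ i ≡ suc N → suc i ≡ 1 ⊎ suc i ≡ 2 + N
      spoke⁻ (inj₁ refl) = inj₁ refl
      spoke⁻ (inj₂ refl) = inj₂ refl

      preserve : ∀ i j → Graph._~_ (cycle N) i j → vertex i ~ vertex j
      preserve zero    zero    (inj₁ ())
      preserve zero    zero    (inj₂ ())
      preserve zero    (suc j) e        = spoke e
      preserve (suc i) zero    e        = ~-sym (spoke e)
      preserve (suc i) (suc j) (inj₁ d) = p-adjacent⁺ (bound i) (bound j) d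
      -- The closing distance `2 + N` is too large for two vertices of the path.
      preserve (suc i) (suc j) (inj₂ d) = contradiction
        (subst (_≤ suc N) d (ℕ.≤-trans (ℕ.∣m-n∣≤m⊔n (toℕ i) (toℕ j)) (ℕ.⊔-lub (bound i) (bound j)))) ℕ.1+n≰n

      reflect : ∀ i j → vertex i ~ vertex j → Graph._~_ (cycle N) i j
      reflect zero    zero    e = contradiction e (~-irrefl refl)
      reflect zero    (suc j) e = spoke⁻ (o-adjacent⁻ (bound j) e)
      reflect (suc i) zero    e = spoke⁻ (o-adjacent⁻ (bound i) (~-sym e))
      reflect (suc i) (suc j) e = inj₁ (p-adjacent⁻ (bound i) (bound j) e)

  module _ {N} (p : ℕ → Fin n) (t : End → Fin 2 → Fin n)
           (p-injective  : ∀ {i j} → i ≤ N → j ≤ N → p i ≡ p j → i ≡ j)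
           (p-adjacent⁺ : ∀ {i j} → i ≤ N → j ≤ N → ∣ i - j ∣ ≡ 1 → p i ~ p j)
           (p-adjacent⁻ : ∀ {i j} → i ≤ N → j ≤ N → p i ~ p j → ∣ i - j ∣ ≡ 1)
           (left⁺ : ∀ z → p 0 ~ t left z) (left⁻ : ∀ z {i} → i ≤ N → p i ~ t left z → i ≡ 0)
           (right⁺ : ∀ z → p N ~ t right z) (right⁻ : ∀ z {i} → i ≤ N → p i ~ t right z → i ≡ N)
           (p≢t : ∀ s z {i} → i ≤ N → p i ≢ t s z)
           (base : ∀ s → t s zero ~ t s (suc zero))
           (separate : ∀ a b → t left a ≢ t right b × ¬ t left a ~ t right b) where

    butterfly-embedding : Embedding (butterfly N) G
    butterfly-embedding = record
      { at        = vertex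
      ; injective = λ {u} {v} → inj u v
      ; preserves = λ {u} {v} → preserve u v
      ; reflects  = λ {u} {v} → reflect u v
      }
      where
      vertex : ButterflyVertex N → Fin n
      vertex (on i)    = p (toℕ i)
      vertex (off s z) = t s z

      bound : (i : Fin (suc N)) → toℕ i ≤ N
      bound = Fin.toℕ≤pred[n]

      base′ : ∀ s {a b} → a ≢ b → t s a ~ t s b
      base′ s {zero}     {zero}     a≢b = contradiction refl a≢b
      base′ s {zero}     {suc zero} _   = base s
      base′ s {suc zero} {zero}     _   = ~-sym (base s)
      base′ s {suc zero} {suc zero} a≢b = contradiction refl a≢b

      inj : ∀ u v → vertex u ≡ vertex v → u ≡ v
      inj (on i)    (on j)    eq = cong on (Fin.toℕ-injective (p-injective (bound i) (bound j) eq))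
      inj (on i)    (off s z) eq = contradiction eq (p≢t s z (bound i))
      inj (off s z) (on i)    eq = contradiction (sym eq) (p≢t s z (bound i))
      inj (off left a)  (off right b) eq = contradiction eq (proj₁ (separate a b))
      inj (off right a) (off left b)  eq = contradiction (sym eq) (proj₁ (separate b a))
      inj (off left a)  (off left b)  eq =
        cong (off left) (decidable-stable (a Fin.≟ b) λ a≢b → ~-irrefl eq (base′ left a≢b))
      inj (off right a) (off right b) eq =
        cong (off right) (decidable-stable (a Fin.≟ b) λ a≢b → ~-irrefl eq (base′ right a≢b))

      end⁺ : ∀ i s z → Graph._~_ (butterfly N) (on i) (off s z) → p (toℕ i) ~ t s z
      end⁺ i left  z e = subst (λ k → p k ~ t left z) (sym e) (left⁺ z)
      end⁺ i right z e = subst (λ k → p k ~ t right z) (sym e) (right⁺ z)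

      end⁻ : ∀ i s z → p (toℕ i) ~ t s z → Graph._~_ (butterfly N) (on i) (off s z)
      end⁻ i left  z e = left⁻ z (bound i) e
      end⁻ i right z e = right⁻ z (bound i) e

      preserve : ∀ u v → Graph._~_ (butterfly N) u v → vertex u ~ vertex v
      preserve (on i)    (on j)    e            = p-adjacent⁺ (bound i) (bound j) e
      preserve (on i)    (off s z) e            = end⁺ i s z e
      preserve (off s z) (on i)    e            = ~-sym (end⁺ i s z e)
      preserve (off s a) (off _ b) (refl , a≢b) = base′ s a≢b

      reflect : ∀ u v → vertex u ~ vertex v → Graph._~_ (butterfly N) u v
      reflect (on i)    (on j)    e = p-adjacent⁻ (bound i) (bound j) e
      reflect (on i)    (off s z) e = end⁻ i s z e
      reflect (off s z) (on i)    e = end⁻ i s z (~-sym e)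
      reflect (off left a)  (off left b)  e = refl , λ a≡b → ~-irrefl (cong (t left) a≡b) e
      reflect (off right a) (off right b) e = refl , λ a≡b → ~-irrefl (cong (t right) a≡b) e
      reflect (off left a)  (off right b) e = contradiction e (proj₂ (separate a b))
      reflect (off right a) (off left b)  e = contradiction (~-sym e) (proj₂ (separate b a))

  claw-embedding : ∀ v (l : Fin 3 → Fin n) → (∀ i → v ~ l i) →
                   (∀ {i j} → l i ≡ l j → i ≡ j) → (∀ i j → ¬ l i ~ l j) → Embedding claw G
  claw-embedding v l v~l l-injective l≁l = record
    { at        = [ (λ _ → v) , l ]′
    ; injective = λ {i} {j} → inj i j
    ; preserves = λ {i} {j} → preserve i j
    ; reflects  = λ {i} {j} → reflect i j
    }
    where
    vertex : Fin 1 ⊎ Fin 3 → Fin n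
    vertex = [ (λ _ → v) , l ]′
    inj : ∀ i j → vertex i ≡ vertex j → i ≡ j
    inj (inj₁ zero) (inj₁ zero) _  = refl
    inj (inj₁ _)    (inj₂ j)    eq = contradiction (v~l j) (~-irrefl eq)
    inj (inj₂ i)    (inj₁ _)    eq = contradiction (v~l i) (~-irrefl (sym eq))
    inj (inj₂ i)    (inj₂ j)    eq = cong inj₂ (l-injective eq)
    preserve : ∀ i j → Graph._~_ claw i j → vertex i ~ vertex j
    preserve (inj₁ _) (inj₂ j) _ = v~l j
    preserve (inj₂ i) (inj₁ _) _ = ~-sym (v~l i)
    reflect : ∀ i j → vertex i ~ vertex j → Graph._~_ claw i j
    reflect (inj₁ _) (inj₁ _) e = contradiction e (~-irrefl refl)
    reflect (inj₁ _) (inj₂ _) _ = _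
    reflect (inj₂ _) (inj₁ _) _ = _
    reflect (inj₂ i) (inj₂ j) e = contradiction e (l≁l i j)

  diamond-embedding : ∀ {a b c d} → a ≢ b → ¬ a ~ b → c ~ d →
                      a ~ c → a ~ d → b ~ c → b ~ d → Embedding diamond G
  diamond-embedding {a} {b} {c} {d} a≢b a≁b cd ac ad bc bd = record
    { at        = vertex
    ; injective = λ {i} {j} → inj i j
    ; preserves = λ {i} {j} → preserve i j
    ; reflects  = λ {i} {j} → reflect i j
    }
    where
    module D = Graph diamond
    vertex : Fin 4 → Fin n
    vertex zero                   = a
    vertex (suc zero)             = b
    vertex (suc (suc zero))       = c
    vertex (suc (suc (suc zero))) = d

    preserve : ∀ i j → i D.~ j → vertex i ~ vertex j
    preserve zero                   zero                   (i≢j , _) = contradiction refl i≢j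
    preserve zero                   (suc zero)             (_ , nab) = contradiction (inj₁ (refl , refl)) nab
    preserve zero                   (suc (suc zero))       _ = ac
    preserve zero                   (suc (suc (suc zero))) _ = ad
    preserve (suc zero)             zero                   (_ , nab) = contradiction (inj₂ (refl , refl)) nab
    preserve (suc zero)             (suc zero)             (i≢j , _) = contradiction refl i≢j
    preserve (suc zero)             (suc (suc zero))       _ = bc
    preserve (suc zero)             (suc (suc (suc zero))) _ = bd
    preserve (suc (suc zero))       zero                   _ = ~-sym ac
    preserve (suc (suc zero))       (suc zero)             _ = ~-sym bc
    preserve (suc (suc zero))       (suc (suc zero))       (i≢j , _) = contradiction refl i≢j
    preserve (suc (suc zero))       (suc (suc (suc zero))) _ = cd
    preserve (suc (suc (suc zero))) zero                   _ = ~-sym ad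
    preserve (suc (suc (suc zero))) (suc zero)             _ = ~-sym bd
    preserve (suc (suc (suc zero))) (suc (suc zero))       _ = ~-sym cd
    preserve (suc (suc (suc zero))) (suc (suc (suc zero))) (i≢j , _) = contradiction refl i≢j

    reflect : ∀ i j → vertex i ~ vertex j → i D.~ j
    reflect i j e = (λ i≡j → ~-irrefl (cong vertex i≡j) e) , λ
      { (inj₁ (refl , refl)) → a≁b e
      ; (inj₂ (refl , refl)) → a≁b (~-sym e) }

    inj : ∀ i j → vertex i ≡ vertex j → i ≡ j
    inj i j eq with i D.~? j
    ... | yes e = contradiction (preserve i j e) (~-irrefl eq)
    -- The only distinct non-adjacent vertices of the diamond are those mapped to `a` and `b`.
    ... | no ¬e = decidable-stable (i Fin.≟ j) λ i≢j → ¬e (i≢j , λ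
          { (inj₁ (refl , refl)) → a≢b eq ; (inj₂ (refl , refl)) → a≢b (sym eq) })

-- Neighbourhoods in claw-free and diamond-free graphs

equal-does : {P Q : Set} (p? : Dec P) (q? : Dec Q) → does p? ≡ does q? → (P × Q) ⊎ (¬ P × ¬ Q)
equal-does (yes p) (yes q) _ = inj₁ (p , q)
equal-does (no ¬p) (no ¬q) _ = inj₂ (¬p , ¬q)

-- In a {claw, diamond}-free graph the neighbourhood of v is the disjoint
-- union of at most two cliques; side v tells them apart.

record Sides {n} (G : Graph (Fin n)) : Set where
  open Graph G
  field
    side : Fin n → Fin n → Bool
    same : ∀ {u v w} → v ~ u → v ~ w → u ~ w → side v u ≡ side v w
    diff : ∀ {u v w} → v ~ u → v ~ w → u ≢ w → ¬ u ~ w → side v u ≢ side v w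

  adjacent : ∀ {u v w} → v ~ u → v ~ w → u ≢ w → side v u ≡ side v w → u ~ w
  adjacent vu vw u≢w eq = decidable-stable (_ ~? _) λ u≁w → diff vu vw u≢w u≁w eq

module _ {n} {G : Graph (Fin n)} (¬claw : ¬ Embedding claw G) (¬diamond : ¬ Embedding diamond G) where
  open Graph G

  private
    -- Two triangles on a common edge `c d` must span a complete graph.
    noDiamond : ∀ {a b c d} → a ≢ b → c ~ d → a ~ c → a ~ d → b ~ c → b ~ d → a ~ b
    noDiamond a≢b cd ac ad bc bd = decidable-stable (_ ~? _) λ a≁b →
      ¬diamond (diamond-embedding a≢b a≁b cd ac ad bc bd)

    noClaw : ∀ {v a b c} → v ~ a → v ~ b → v ~ c → a ≢ b → a ≢ c → b ≢ c → ¬ a ~ b → ¬ a ~ c → b ~ c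
    noClaw {v} {a} {b} {c} va vb vc a≢b a≢c b≢c a≁b a≁c = decidable-stable (_ ~? _) λ b≁c →
      ¬claw (claw-embedding v (triple {G = G} a b c)
        (λ { zero → va ; (suc zero) → vb ; (suc (suc zero)) → vc })
        (triple-injective {G = G} a≢b a≢c b≢c)
        (independent b≁c))
      where
      independent : ¬ b ~ c → ∀ i j → ¬ triple {G = G} a b c i ~ triple {G = G} a b c j
      independent b≁c zero             zero             = ~-irrefl refl
      independent b≁c zero             (suc zero)       = a≁b
      independent b≁c zero             (suc (suc zero)) = a≁c
      independent b≁c (suc zero)       zero             = a≁b ∘ ~-sym
      independent b≁c (suc zero)       (suc zero)       = ~-irrefl refl
      independent b≁c (suc zero)       (suc (suc zero)) = b≁c
      independent b≁c (suc (suc zero)) zero             = a≁c ∘ ~-sym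
      independent b≁c (suc (suc zero)) (suc zero)       = b≁c ∘ ~-sym
      independent b≁c (suc (suc zero)) (suc (suc zero)) = ~-irrefl refl

    _≃?_ : ∀ r u → Dec (u ≡ r ⊎ u ~ r)
    r ≃? u = (u Fin.≟ r) ⊎-dec (u ~? r)

    -- A reference neighbour `r` decides which clique is called true, namely its own. An isolated
    -- vertex has no neighbours to separate.
    sideᵛ : ∀ v → Dec (∃[ r ] v ~ r) → Fin n → Bool
    sideᵛ v (yes (r , _)) u = does (r ≃? u)
    sideᵛ v (no _)        u = false

    neighbour? : ∀ v → Dec (∃[ r ] v ~ r)
    neighbour? v = Fin.any? (v ~?_)

    -- Adjacency among neighbours of `v` is transitive: the triangles of `w` and of `r` with `v u`
    -- share that edge.
    close : ∀ {v r u w} → v ~ r → v ~ u → v ~ w → u ~ w → u ≡ r ⊎ u ~ r → w ≡ r ⊎ w ~ r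
    close vr vu vw uw (inj₁ refl) = inj₂ (~-sym uw)
    close {v} {r} {u} {w} vr vu vw uw (inj₂ ur) with w Fin.≟ r
    ... | yes w≡r = inj₁ w≡r
    ... | no w≢r  = inj₂ (noDiamond w≢r vu (~-sym vw) (~-sym uw) (~-sym vr) (~-sym ur))

  sides : Sides G
  sides = record
    { side = λ v → sideᵛ v (neighbour? v)
    ; same = λ {u} {v} {w} vu vw uw → same′ (neighbour? v) vu vw uw
    ; diff = λ {u} {v} {w} vu vw u≢w u≁w → diff′ (neighbour? v) vu vw u≢w u≁w
    }
    where
    same′ : ∀ {u v w} d → v ~ u → v ~ w → u ~ w → sideᵛ v d u ≡ sideᵛ v d w
    same′ (no _) _ _ _ = refl
    same′ {u} {v} {w} (yes (r , vr)) vu vw uw =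
      does-⇔ (mk⇔ (close vr vu vw uw) (close vr vw vu (~-sym uw))) (r ≃? u) (r ≃? w)

    diff′ : ∀ {u v w} d → v ~ u → v ~ w → u ≢ w → ¬ u ~ w → sideᵛ v d u ≢ sideᵛ v d w
    diff′ (no ¬r) vu _ _ _ _ = ¬r (_ , vu)
    diff′ {u} {v} {w} (yes (r , vr)) vu vw u≢w u≁w eq with equal-does (r ≃? u) (r ≃? w) eq
    ... | inj₁ (inj₁ refl , inj₁ refl) = u≢w refl
    ... | inj₁ (inj₁ refl , inj₂ wr)   = u≁w (~-sym wr)
    ... | inj₁ (inj₂ ur , inj₁ refl)   = u≁w ur
    ... | inj₁ (inj₂ ur , inj₂ wr)     = u≁w (noDiamond u≢w vr (~-sym vu) ur (~-sym vw) wr)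
    -- Neither `u` nor `w` belongs to the clique of `r`, so a missing edge between them would give a
    -- claw with leaves `r`, `u`, `w`.
    ... | inj₂ (¬p , ¬q)               = u≁w (noClaw vr vu vw
      (λ r≡u → ¬p (inj₁ (sym r≡u))) (λ r≡w → ¬q (inj₁ (sym r≡w))) u≢w
      (λ ru → ¬p (inj₂ (~-sym ru))) (λ rw → ¬q (inj₂ (~-sym rw))))

-- Solving the phase equations one vertex at a time

parity : ∀ n → ∃[ k ] (n ≡ 2 * k ⊎ n ≡ suc (2 * k))
parity zero = 0 , inj₁ refl
parity (suc n) with parity n
... | k , inj₁ eq = k , inj₂ (cong suc eq)
... | k , inj₂ eq = suc k , inj₁ (trans (cong suc eq) (sym (ℕ.*-suc 2 k)))

NoOddHole : ∀ {n} → Graph (Fin n) → Set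
NoOddHole G = ∀ k → ¬ Embedding (cycle (2 + 2 * k)) G

-- phase v tells the colour of the clique on side false of v.

record Balanced {n} {G : Graph (Fin n)} (S : Sides G) : Set where
  open Graph G
  open Sides S
  field
    phase          : Fin n → Bool
    component      : Fin n → Fin n
    balanced       : ∀ {u v} → u ~ v → phase u xor side u v ≡ phase v xor side v u
    component-cong : ∀ {u v} → u ~ v → component u ≡ component v
    connected      : ∀ {u v} → component u ≡ component v → Star _~_ u v

delete₀ : ∀ {n} → Graph (Fin (suc n)) → Graph (Fin n)
delete₀ G = record
  { _~_      = λ u v → suc u ~ suc v
  ; ~-sym    = ~-sym
  ; ~-irrefl = λ { refl → ~-irrefl refl }
  ; _~?_     = λ u v → suc u ~? suc v
  }
  where open Graph G

xor-cancelʳ : ∀ {a b} c → a xor c ≡ b xor c → a ≡ b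
xor-cancelʳ {a} {b} c eq = trans (sym (cancel a c)) (trans (cong (_xor c) eq) (cancel b c))
  where
  cancel : ∀ a c → (a xor c) xor c ≡ a
  cancel a c = trans (Bool.xor-assoc a c c) (trans (cong (a xor_) (Bool.xor-same c)) (Bool.xor-identityʳ a))

xor-swap : ∀ a b c → (a xor b) xor c ≡ (a xor c) xor b
xor-swap a b c = trans (Bool.xor-assoc a b c)
  (trans (cong (a xor_) (Bool.xor-comm b c)) (sym (Bool.xor-assoc a c b)))

module AddVertex {n} {G : Graph (Fin (suc n))} (S : Sides G) (¬hole : NoOddHole G) where
  open Graph G
  open Sides S

  S₀ : Sides (delete₀ G)
  S₀ = record
    { side = λ u v → side (suc u) (suc v)
    ; same = same
    ; diff = λ vu vw u≢w → diff vu vw (u≢w ∘ Fin.suc-injective)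
    }

  ¬hole₀ : NoOddHole (delete₀ G)
  ¬hole₀ k ι = ¬hole k (record
    { at = suc ∘ at ; injective = injective ∘ Fin.suc-injective ; preserves = preserves ; reflects = reflects })
    where open Embedding ι

  module _ (bal : Balanced S₀) where
    open Balanced bal

    -- the hue of the edge from u to zero, as seen from u, and the phase
    -- shift that the component of u needs when zero gets phase false
    spoke shift : Fin n → Bool
    spoke u = phase u xor side (suc u) zero
    shift u = spoke u xor side zero (suc u)

    -- If `u` and `w` differ, they form a triangle with `zero`. Seen from `u`, the vertices `zero`
    -- and `w` are then on the same side, and likewise from `w`, so the equation of the edge `u w`
    -- already equates the two spokes.
    shift-same-side : ∀ {u w} → zero ~ suc u → zero ~ suc w → side zero (suc u) ≡ side zero (suc w) →
                      shift u ≡ shift w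
    shift-same-side {u} {w} zu zw eq with u Fin.≟ w
    ... | yes refl = refl
    ... | no u≢w = cong₂ _xor_ (begin
        phase u xor side (suc u) zero    ≡⟨ cong (phase u xor_) (same (~-sym zu) uw zw) ⟩
        phase u xor side (suc u) (suc w) ≡⟨ balanced uw ⟩
        phase w xor side (suc w) (suc u) ≡⟨ cong (phase w xor_) (same (~-sym zw) (~-sym uw) zu) ⟨
        phase w xor side (suc w) zero    ∎) eq
      where
      open ≡-Reasoning
      uw : suc u ~ suc w
      uw = adjacent zu zw (u≢w ∘ Fin.suc-injective) eq

    Spoke : Bool → Pred (Fin n) 0ℓ
    Spoke b v = zero ~ suc v × side zero (suc v) ≡ b

    module Around {b} (sp : ShortestPath {G = delete₀ G} (Spoke (not b)) (Spoke b)) where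
      open ShortestPath sp

      spoke-ends : ∀ {i} → i ≤ len → zero ~ suc (p i) → i ≡ 0 ⊎ i ≡ len
      spoke-ends {i} i≤len e with side zero (suc (p i)) Bool.≟ b
      ... | yes eq = inj₂ (B-end i≤len (e , eq))
      ... | no ¬eq = inj₁ (A-start i≤len (e , ¬-not ¬eq))

      ends-apart : ¬ suc (p 0) ~ suc (p len)
      ends-apart e = not-¬ refl (trans (sym (proj₂ finish))
        (trans (sym (same (proj₁ start) (proj₁ finish) e)) (proj₂ start)))

      -- Length 0 would put one vertex on both sides of `zero`, and length 1 contradicts
      -- `ends-apart`.
      two≤len : 2 ≤ len
      two≤len = decidable-stable (2 ℕ.≤? len) λ 2≰len → small (ℕ.≤-pred (ℕ.≰⇒> 2≰len))
        where
        small : ¬ len ≤ 1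
        small len≤1 with 1 ℕ.≤? len
        ... | yes 1≤len = ends-apart
          (subst (λ i → suc (p 0) ~ suc (p i)) (ℕ.≤-antisym 1≤len len≤1) (edge 1≤len))
        ... | no 1≰len = not-¬ refl (trans (sym (proj₂ finish))
          (trans (cong (λ i → side zero (suc (p i))) (ℕ.n<1⇒n≡0 (ℕ.≰⇒> 1≰len))) (proj₂ start)))

      ¬spoke : ∀ {i} → suc i < len → ¬ zero ~ suc (p (suc i))
      ¬spoke si<len e with spoke-ends (ℕ.<⇒≤ si<len) e
      ... | inj₂ eq = ℕ.<⇒≢ si<len eq

      -- The unshifted hue of the edge entering `p i`, as seen from `p i`, with `zero` as the
      -- predecessor of `p 0`.
      e : ℕ → Bool
      e zero    = spoke (p 0)
      e (suc i) = phase (p (suc i)) xor side (suc (p (suc i))) (suc (p i))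

      phase-step : ∀ i {a c} → suc (p i) ~ a → suc (p i) ~ c → a ≢ c → ¬ a ~ c →
                   phase (p i) xor side (suc (p i)) c ≡ not (phase (p i) xor side (suc (p i)) a)
      phase-step i {a} {c} pa pc a≢c a≁c = trans (cong (phase (p i) xor_) (¬-not (≢-sym (diff pa pc a≢c a≁c))))
        (sym (Bool.not-distribʳ-xor (phase (p i)) (side (suc (p i)) a)))

      -- `balanced` carries the hue of the edge over to `p i`, where it is opposite to the hue of
      -- the entering edge because the path is induced and `zero` meets only its ends.
      e-step : ∀ {i} → i < len → e (suc i) ≡ not (e i)
      e-step {zero} 0<len = trans (sym (balanced (edge 0<len)))
        (phase-step 0 (~-sym (proj₁ start)) (edge 0<len) (λ ()) (¬spoke two≤len))
      e-step {suc i} si<len = trans (sym (balanced (edge si<len)))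
        (phase-step (suc i) (~-sym (edge (ℕ.<⇒≤ si<len))) (edge si<len)
          (proj₁ (p-turn si<len) ∘ Fin.suc-injective) (proj₂ (p-turn si<len)))

      e-last : ∀ {l} → len ≡ 2 + l → spoke (p len) ≡ not (e len)
      e-last {l} refl = phase-step len (~-sym (edge ℕ.≤-refl)) (~-sym (proj₁ finish))
        (λ ()) (¬spoke ℕ.≤-refl ∘ ~-sym)

      -- For even `len` the two spokes have different hues, but the ends also lie on different sides
      -- of `zero`, and the two negations cancel. For odd `len` the path and `zero` form an induced
      -- cycle with `len + 2` vertices.
      shift-ends : shift (p 0) ≡ shift (p len)
      shift-ends with parity len
      ... | k , inj₁ len≡2k = begin
          e 0 xor side zero (suc (p 0))             ≡⟨ cong₂ _xor_ e-even sides-differ ⟩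
          e len xor not (side zero (suc (p len)))   ≡⟨ Bool.not-distribʳ-xor (e len) _ ⟨
          not (e len xor side zero (suc (p len)))   ≡⟨ Bool.not-distribˡ-xor (e len) _ ⟩
          not (e len) xor side zero (suc (p len))   ≡⟨ cong (_xor side zero (suc (p len))) e-last′ ⟨
          spoke (p len) xor side zero (suc (p len)) ∎
        where
        open ≡-Reasoning
        sides-differ : side zero (suc (p 0)) ≡ not (side zero (suc (p len)))
        sides-differ = trans (proj₂ start) (cong not (sym (proj₂ finish)))
        e-last′ : spoke (p len) ≡ not (e len)
        e-last′ = e-last (sym (ℕ.m+[n∸m]≡n two≤len))
        e-even : e 0 ≡ e len
        e-even = sym (subst (λ l → e l ≡ e 0) (sym len≡2k)
          (alternating-even e k λ i< → e-step (subst (_ <_) (sym len≡2k) i<)))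
      ... | zero , inj₂ len≡1 = contradiction (subst (2 ≤_) len≡1 two≤len) ℕ.1+n≰n
      ... | suc k , inj₂ len≡ = contradiction (cycle-embedding {G = G} {N = N} zero (suc ∘ p)
            (λ i≤ j≤ eq → p-injective (bound i≤) (bound j≤) (Fin.suc-injective eq))
            (λ i≤ j≤ → p-adjacent⁺ (bound i≤) (bound j≤))
            (λ i≤ j≤ → p-adjacent⁻ (bound i≤) (bound j≤))
            (proj₁ start) (subst (λ l → zero ~ suc (p l)) len≡′ (proj₁ finish))
            (λ i≤ e → subst (λ l → _ ≡ 0 ⊎ _ ≡ l) len≡′ (spoke-ends (bound i≤) e))
            (λ _ ()))
          (¬hole k)
        where
        -- Length 1 being excluded, `len` is `3 + 2 * k`, and the path with `zero` has
        -- `3 + N = 5 + 2 * k` vertices.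
        N = 2 + 2 * k
        len≡′ : len ≡ suc N
        len≡′ = trans len≡ (cong suc (ℕ.*-suc 2 k))
        bound : ∀ {i} → i ≤ suc N → i ≤ len
        bound = subst (_ ≤_) (sym len≡′)

    -- The shortest path may end at other vertices than `u` and `w`, but these lie in the same
    -- cliques of `zero`, where `shift-same-side` applies.
    shift-cong : ∀ {u w} → zero ~ suc u → zero ~ suc w → component u ≡ component w → shift u ≡ shift w
    shift-cong {u} {w} zu zw u≈w with side zero (suc u) Bool.≟ side zero (suc w)
    ... | yes eq = shift-same-side zu zw eq
    ... | no ¬eq = trans (shift-same-side zu (proj₁ start) (sym (proj₂ start′)))
        (trans (Around.shift-ends sp) (sym (shift-same-side zw (proj₁ finish) (sym (proj₂ finish)))))
      where
      b = side zero (suc w)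
      Spoke? : ∀ b → Decidable (Spoke b)
      Spoke? b v = (zero ~? suc v) ×-dec (side zero (suc v) Bool.≟ b)
      sp : ShortestPath {G = delete₀ G} (Spoke (not b)) (Spoke b)
      sp = shortestPath (Spoke? (not b)) (Spoke? b) (zu , ¬-not ¬eq) (zw , refl) (connected u≈w)
      open ShortestPath sp
      start′ : Spoke (side zero (suc u)) (p 0)
      start′ = subst (λ c → Spoke c (p 0)) (sym (¬-not ¬eq)) start

    Touched : Pred (Fin n) 0ℓ
    Touched c = ∃[ u ] zero ~ suc u × component u ≡ c

    touched? : Decidable Touched
    touched? c = Fin.any? λ u → (zero ~? suc u) ×-dec (component u Fin.≟ c)

    shiftOf : ∀ {c} → Dec (Touched c) → Bool
    shiftOf (yes (u , _)) = shift u
    -- A component without a neighbour of `zero` keeps its phases.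
    shiftOf (no _)        = false

    -- All components touching `zero` become the component of `zero`; the others keep their identity
    -- under new names.
    mergeOf : ∀ {c} → Dec (Touched c) → Fin (suc n)
    mergeOf     (yes _) = zero
    mergeOf {c} (no _)  = suc c

    shiftOf-touched : ∀ {u} → zero ~ suc u → (d : Dec (Touched (component u))) → shiftOf d ≡ shift u
    shiftOf-touched zu (yes (v , zv , v≈u)) = shift-cong zv zu v≈u
    shiftOf-touched zu (no ¬t)              = contradiction (_ , zu , refl) ¬t

    merge-touched : ∀ {u} → zero ~ suc u → (d : Dec (Touched (component u))) → mergeOf d ≡ zero
    merge-touched zu (yes _) = refl
    merge-touched zu (no ¬t) = contradiction (_ , zu , refl) ¬t

    merge-zero : ∀ {u} (d : Dec (Touched (component u))) → mergeOf d ≡ zero → Star _~_ zero (suc u)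
    merge-zero (yes (v , zv , v≈u)) _ = zv ◅ gmap suc id (connected v≈u)

    merge-connected : ∀ {u w} (d : Dec (Touched (component u)))
      (d′ : Dec (Touched (component w))) → mergeOf d ≡ mergeOf d′ → Star _~_ (suc u) (suc w)
    merge-connected d@(yes _) d′@(yes _) _  = reverse ~-sym (merge-zero d refl) ◅◅ merge-zero d′ refl
    merge-connected (no _)    (no _)     eq = gmap suc id (connected (Fin.suc-injective eq))

    phase⁺ : Fin (suc n) → Bool
    phase⁺ zero    = false
    phase⁺ (suc u) = phase u xor shiftOf (touched? (component u))

    component⁺ : Fin (suc n) → Fin (suc n)
    component⁺ zero    = zero
    component⁺ (suc u) = mergeOf (touched? (component u))

    -- `shift u` is by definition the solution of this equation, and `shift-cong` makes it the shift
    -- of the whole component.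
    zero-balanced : ∀ {u} → zero ~ suc u → side zero (suc u) ≡ phase⁺ (suc u) xor side (suc u) zero
    zero-balanced {u} zu = begin
      side zero (suc u)                           ≡⟨ cancel (spoke u) _ ⟨
      spoke u xor shift u                         ≡⟨ xor-swap (phase u) _ (shift u) ⟩
      (phase u xor shift u) xor side (suc u) zero ≡⟨ cong (λ t → (phase u xor t) xor side (suc u) zero) shifted ⟨
      phase⁺ (suc u) xor side (suc u) zero        ∎
      where
      shifted = shiftOf-touched zu (touched? (component u))
      open ≡-Reasoning
      cancel : ∀ a b → a xor (a xor b) ≡ b
      cancel a b = trans (sym (Bool.xor-assoc a a b)) (cong (_xor b) (Bool.xor-same a))

    balanced⁺ : Balanced S
    balanced⁺ = record
      { phase = phase⁺
      ; component = component⁺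
      ; balanced = λ {u} {v} → bal⁺ u v
      ; component-cong = λ {u} {v} → comp⁺ u v
      ; connected = λ {u} {v} → conn⁺ u v
      }
      where
      bal⁺ : ∀ u v → u ~ v → phase⁺ u xor side u v ≡ phase⁺ v xor side v u
      bal⁺ zero    zero    e = contradiction e (~-irrefl refl)
      bal⁺ zero    (suc v) e = zero-balanced e
      bal⁺ (suc u) zero    e = sym (zero-balanced (~-sym e))
      bal⁺ (suc u) (suc v) e = trans (xor-swap (phase u) _ _)
        (trans (cong₂ _xor_ (balanced e) (cong (shiftOf ∘ touched?) (component-cong e)))
               (xor-swap (phase v) _ _))
      comp⁺ : ∀ u v → u ~ v → component⁺ u ≡ component⁺ v
      comp⁺ zero    zero    e = refl
      comp⁺ zero    (suc v) e = sym (merge-touched e (touched? (component v)))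
      comp⁺ (suc u) zero    e = merge-touched (~-sym e) (touched? (component u))
      comp⁺ (suc u) (suc v) e = cong (mergeOf ∘ touched?) (component-cong e)
      conn⁺ : ∀ u v → component⁺ u ≡ component⁺ v → Star _~_ u v
      conn⁺ zero    zero    _  = ε
      conn⁺ zero    (suc v) eq = merge-zero (touched? (component v)) (sym eq)
      conn⁺ (suc u) zero    eq = reverse ~-sym (merge-zero (touched? (component u)) eq)
      conn⁺ (suc u) (suc v) eq = merge-connected (touched? (component u)) (touched? (component v)) eq

balance : ∀ {n} {G : Graph (Fin n)} (S : Sides G) → NoOddHole G → Balanced S
balance {zero}  S ¬hole = record
  { phase = λ () ; component = λ () ; balanced = λ { {()} }
  ; component-cong = λ { {()} } ; connected = λ { {()} } }
balance {suc n} S ¬hole = balanced⁺ (balance S₀ ¬hole₀)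
  where open AddVertex S ¬hole

-- Giving all triangles the value true

module FromBalanced {n} {G : Graph (Fin n)} (S : Sides G) (bal : Balanced S)
                    (¬butterfly : ∀ k → ¬ Embedding (butterfly (2 * k)) G) where
  open Graph G
  open Sides S
  open Balanced bal

  -- Symmetric on edges by `balanced` and alternating at turns, but of unknown value on triangles;
  -- flipping it on whole components preserves both properties.
  rawHue : Fin n → Fin n → Bool
  rawHue u v = phase u xor side u v

  rawHue-turn : ∀ {u v w} → v ~ u → v ~ w → u ≢ w → ¬ u ~ w → rawHue v w ≡ not (rawHue v u)
  rawHue-turn {u} {v} {w} vu vw u≢w u≁w = trans (cong (phase v xor_) (¬-not (≢-sym (diff vu vw u≢w u≁w))))
    (sym (Bool.not-distribʳ-xor (phase v) (side v u)))

  rawHue-same : ∀ {u v w} → v ~ u → v ~ w → u ~ w → rawHue v u ≡ rawHue v w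
  rawHue-same {v = v} vu vw uw = cong (phase v xor_) (same vu vw uw)

  -- One edge determines the value of the triangle, since all its edges have equal raw hue by
  -- `rawHue-same` and `balanced`.
  Triangle : Bool → Pred (Fin n) 0ℓ
  Triangle t v = ∃[ a ] ∃[ b ] v ~ a × v ~ b × a ~ b × rawHue v a ≡ t

  triangle? : ∀ t → Decidable (Triangle t)
  triangle? t v = Fin.any? λ a → Fin.any? λ b →
    (v ~? a) ×-dec ((v ~? b) ×-dec ((a ~? b) ×-dec (rawHue v a Bool.≟ t)))

  triangle-rotate : ∀ {t v a b} → v ~ a → v ~ b → a ~ b → rawHue v a ≡ t → Triangle t a
  triangle-rotate va vb ab eq = _ , _ , ~-sym va , ab , vb , trans (sym (balanced va)) eq

  module Conflict (sp : ShortestPath {G = G} (Triangle false) (Triangle true)) where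
    open ShortestPath sp

    tip : End → Fin 2 → Fin n
    tip left  zero       = proj₁ start
    tip left  (suc zero) = proj₁ (proj₂ start)
    tip right zero       = proj₁ finish
    tip right (suc zero) = proj₁ (proj₂ finish)

    apex : End → Fin n
    apex left  = p 0
    apex right = p len

    colour-of : End → Bool
    colour-of left  = false
    colour-of right = true

    tip-adjacent : ∀ s z → apex s ~ tip s z
    tip-adjacent left  zero       = let _ , _ , va , vb , ab , _ = start  in va
    tip-adjacent left  (suc zero) = let _ , _ , va , vb , ab , _ = start  in vb
    tip-adjacent right zero       = let _ , _ , va , vb , ab , _ = finish in va
    tip-adjacent right (suc zero) = let _ , _ , va , vb , ab , _ = finish in vb

    base : ∀ s → tip s zero ~ tip s (suc zero)
    base left  = let _ , _ , va , vb , ab , _ = start  in ab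
    base right = let _ , _ , va , vb , ab , _ = finish in ab

    tip-hue : ∀ s z → rawHue (apex s) (tip s z) ≡ colour-of s
    tip-hue left  zero       = let _ , _ , va , vb , ab , eq = start  in eq
    tip-hue left  (suc zero) = let _ , _ , va , vb , ab , eq = start  in trans (sym (rawHue-same va vb ab)) eq
    tip-hue right zero       = let _ , _ , va , vb , ab , eq = finish in eq
    tip-hue right (suc zero) = let _ , _ , va , vb , ab , eq = finish in trans (sym (rawHue-same va vb ab)) eq

    tip-triangle : ∀ s z → Triangle (colour-of s) (tip s z)
    tip-triangle s zero       =
      triangle-rotate (tip-adjacent s zero) (tip-adjacent s (suc zero)) (base s) (tip-hue s zero)
    tip-triangle s (suc zero) =
      triangle-rotate (tip-adjacent s (suc zero)) (tip-adjacent s zero) (~-sym (base s)) (tip-hue s (suc zero))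

    -- A further vertex of the clique spanned by an end triangle would be a
    -- better end of the path.
    clique-triangle : ∀ s z {u} → apex s ~ u → u ~ tip s z → Triangle (colour-of s) u
    clique-triangle s z au ut = triangle-rotate au (tip-adjacent s z) ut
      (trans (rawHue-same au (tip-adjacent s z) ut) (tip-hue s z))

    -- `A-near` leaves only `p 1` to exclude; adjacent to both `p 0` and the tip, it would lie on a
    -- false triangle and be a later vertex of the path in the starting set.
    left⁻ : ∀ z {i} → i ≤ len → p i ~ tip left z → i ≡ 0
    left⁻ z {zero}  i≤len e = refl
    left⁻ z {suc i} i≤len e with A-near (tip-triangle left z) i≤len (~-sym e)
    ... | s≤s z≤n = A-start i≤len (clique-triangle left z (edge i≤len) e)

    right⁻ : ∀ z {i} → i ≤ len → p i ~ tip right z → i ≡ len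
    right⁻ z {i} i≤len e with ℕ.m≤n⇒m<n∨m≡n i≤len
    ... | inj₂ i≡len = i≡len
    ... | inj₁ i<len = B-end i≤len (clique-triangle right z (~-sym last-edge) e)
      where
      last-edge : p i ~ p len
      last-edge = subst (λ j → p i ~ p j)
        (ℕ.≤-antisym i<len (B-near (tip-triangle right z) i≤len e)) (edge i<len)

    p≢tip : ∀ s z {i} → i ≤ len → p i ≢ tip s z
    p≢tip left z {i} i≤len eq = ~-irrefl (trans (cong p (sym i≡0)) eq) (tip-adjacent left z)
      where i≡0 = A-start i≤len (subst (Triangle false) (sym eq) (tip-triangle left z))
    p≢tip right z {i} i≤len eq = ~-irrefl (trans (cong p (sym i≡len)) eq) (tip-adjacent right z)
      where i≡len = B-end i≤len (subst (Triangle true) (sym eq) (tip-triangle right z))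

    e : ℕ → Bool
    e zero    = rawHue (p 0) (tip left zero)
    e (suc i) = rawHue (p (suc i)) (p i)

    e-step : ∀ {i} → i < len → e (suc i) ≡ not (e i)
    e-step {zero} 0<len = trans (sym (balanced (edge 0<len)))
      (rawHue-turn (tip-adjacent left zero) (edge 0<len) (≢-sym (p≢tip left zero 0<len))
        (λ a → case left⁻ zero 0<len (~-sym a) of λ ()))
    e-step {suc i} si<len = trans (sym (balanced (edge si<len)))
      (rawHue-turn (~-sym (edge (ℕ.<⇒≤ si<len))) (edge si<len) (proj₁ (p-turn si<len)) (proj₂ (p-turn si<len)))

    -- Hues alternate starting from a false edge of the left triangle, so after an odd path the edge
    -- into the right triangle would be false too.
    ¬odd : ∀ k → len ≢ suc (2 * k)
    ¬odd k len≡ = case trans (sym (tip-hue right zero))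
      (subst (λ l → rawHue (p l) (tip right zero) ≡ false) (sym len≡) hue-end) of λ ()
      where
      2k<len : 2 * k < len
      2k<len = ℕ.≤-reflexive (sym len≡)
      e-end : e (suc (2 * k)) ≡ true
      e-end = trans (e-step 2k<len) (cong not (trans
        (alternating-even e k (λ i< → e-step (ℕ.<-trans i< 2k<len))) (tip-hue left zero)))
      hue-end : rawHue (p (suc (2 * k))) (tip right zero) ≡ false
      hue-end = trans (rawHue-turn (~-sym (edge 2k<len))
          (subst (λ l → p l ~ tip right zero) len≡ (tip-adjacent right zero))
          (p≢tip right zero (ℕ.<⇒≤ 2k<len)) (λ a → ℕ.<⇒≢ 2k<len (right⁻ zero (ℕ.<⇒≤ 2k<len) a)))
        (cong not e-end)

    len≤1⇒zero : len ≤ 1 → len ≡ 0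
    len≤1⇒zero len≤1 with ℕ.m≤n⇒m<n∨m≡n len≤1
    ... | inj₁ len<1 = ℕ.n<1⇒n≡0 len<1
    ... | inj₂ len≡1 = contradiction len≡1 (¬odd 0)

    hues-at-zero : len ≡ 0 → ∀ a b → rawHue (p 0) (tip left a) ≢ rawHue (p 0) (tip right b)
    hues-at-zero len≡0 a b eq = case trans (sym (tip-hue left a)) (trans eq
      (subst (λ l → rawHue (p l) (tip right b) ≡ true) len≡0 (tip-hue right b))) of λ ()

    -- Every tip is itself a possible end of the path. Equal or adjacent tips therefore give
    -- `len ≤ 1`, hence `len ≡ 0` by parity, and at the common apex the tips are told apart by their
    -- hues.
    separate : ∀ a b → tip left a ≢ tip right b × ¬ tip left a ~ tip right b
    separate a b = apart , non-adjacent
      where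
      apart : tip left a ≢ tip right b
      apart eq = hues-at-zero (ℕ.n≤0⇒n≡0 (shortest (tip-triangle left a)
        (stop (subst (Triangle true) (sym eq) (tip-triangle right b))))) a b (cong (rawHue (p 0)) eq)
      non-adjacent : ¬ tip left a ~ tip right b
      non-adjacent ab = hues-at-zero len≡0 a b (rawHue-same (tip-adjacent left a)
          (subst (λ l → p l ~ tip right b) len≡0 (tip-adjacent right b)) ab)
        where len≡0 = len≤1⇒zero (shortest (tip-triangle left a) (step ab (stop (tip-triangle right b))))

    conflict : ⊥
    conflict with parity len
    ... | k , inj₂ odd  = ¬odd k odd
    ... | k , inj₁ even = ¬butterfly k (subst (λ N → Embedding (butterfly N) G) even
      (butterfly-embedding {G = G} p tip p-injective p-adjacent⁺ p-adjacent⁻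
        (tip-adjacent left) left⁻ (tip-adjacent right) right⁻ p≢tip base separate))

  no-conflict : ∀ {u v} → component u ≡ component v → Triangle false u → ¬ Triangle true v
  no-conflict u≈v tu tv = Conflict.conflict
    (shortestPath {G = G} (triangle? false) (triangle? true) tu tv (connected u≈v))

  false-triangle? : ∀ c → Dec (∃[ u ] component u ≡ c × Triangle false u)
  false-triangle? c = Fin.any? λ u → (component u Fin.≟ c) ×-dec triangle? false u

  -- Depends on the component only. By `no-conflict`, a component that is flipped because of a false
  -- triangle contains no true one.
  flipped : Fin n → Bool
  flipped u = does (false-triangle? (component u))

  cliqueColouring : CliqueColouring G
  cliqueColouring = record
    { hue      = λ u v → rawHue u v xor flipped u
    ; hue-sym  = λ e → cong₂ _xor_ (balanced e) (cong (does ∘ false-triangle?) (component-cong e))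
    ; turn     = λ {u} {v} vu vw u≢w u≁w eq →
        not-¬ refl (trans (xor-cancelʳ (flipped v) eq) (rawHue-turn vu vw u≢w u≁w))
    ; triangle-true = triangle-true
    }
    where
    triangle-true : ∀ {u v w} → u ~ v → u ~ w → v ~ w → rawHue u v xor flipped u ≡ true
    triangle-true {u} {v} {w} uv uw vw with rawHue u v in eq
    ... | false = dec-true (false-triangle? (component u)) (u , refl , _ , _ , uv , uw , vw , eq)
    ... | true  = cong not (dec-false (false-triangle? (component u))
      λ (u′ , u′≈u , t) → no-conflict u′≈u t (_ , _ , uv , uw , vw , eq))

-- The equivalences

free⇒clique : ∀ {n} {G : Graph (Fin n)} → ClawDiamondOddHoleEvenButterfly -Free G → CliqueColouring G
free⇒clique {G = G} free = FromBalanced.cliqueColouring S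
  (balance S λ k → free⇒¬embedding searchFin (is-odd-hole k) free)
  (λ k → free⇒¬embedding searchButterfly (is-even-butterfly k) free)
  where
  S : Sides G
  S = sides (free⇒¬embedding (searchSum searchFin searchFin) is-claw free)
            (free⇒¬embedding searchFin is-diamond free)

theorem16 : ∀ n (G : Graph (Fin n)) →
    let
    [1] = Σ[ c ∈ Colouring G ] ColourFree (ʳP₃ ∷ ᵇP₃ ∷ ᵇK₃ ∷ ʳʳᵇK₃ ∷ ʳᵇᵇK₃ ∷ []) c
    [2] = Σ[ c ∈ Colouring G ] ColourFree (ʳP₃ ∷ ᵇP₃ ∷ ʳK₃ ∷ ʳʳᵇK₃ ∷ ʳᵇᵇK₃ ∷ []) c
    [3] = IsLineGraphOfIncidenceGraph G
    [4] = ClawDiamondOddHoleEvenButterfly -Free G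
    in ([1] ⇔ [2]) × ([2] ⇔ [3]) × ([3] ⇔ [4])
theorem16 n G =
    ⇔.trans (colouring⇔clique red) (⇔.sym (colouring⇔clique blue))
  , ⇔.trans (colouring⇔clique blue) (⇔.sym lineGraph⇔clique)
  , ⇔.trans lineGraph⇔clique (mk⇔ clique⇒free free⇒clique)
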